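{- Let $q$ be a prime power and let $n$ be a positive integer with $\gcd(n,q)=1$. Let $\operatorname{Aut}_q(n):=\operatorname{Aut}\big(\operatorname{Cyc}(\langle q\rangle,\mathbb{Z}_n)\big)$ be the automorphism group of the cyclotomic association scheme of the subgroup $\langle q\rangle\le\mathbb{Z}_n^\times$ acting on $\mathbb{Z}_n$ by multiplication. Then $$\bigcap_{C}\operatorname{PAut}(C)=\operatorname{Aut}_q(n),$$ where $C$ runs over all cyclic codes of length $n$ over $\mathbb{F}_q$.
   Context: Write $\mathbb{Z}_n=\mathbb{Z}/n\mathbb{Z}$ and $\Omega:=\mathbb{Z}_n$. Let $\langle q\rangle$ be the subgroup of $\mathbb{Z}_n^\times$ generated by $q$, and for $a\in\mathbb{Z}_n$ let $a\langle q\rangle=\{ak:k\in\langle q\rangle\}$ be its orbit under multiplication. The cyclotomic association scheme $\operatorname{Cyc}(\langle q\rangle,\mathbb{Z}_n)$ is the pair $(\mathbb{Z}_n,\pi)$, where $\pi$ is the coloring of ordered pairs by orbits, $\pi(x,y):=(y-x)\langle q\rangle$ for $x,y\in\mathbb{Z}_n$. Its automorphism group is the group of all permutations $\sigma\in\operatorname{Sym}(\mathbb{Z}_n)$ with $\pi(\sigma x,\sigma y)=\pi(x,y)$ for all $x,y\in\mathbb{Z}_n$. The space $\mathbb{F}_q^\Omega$ of functions $\Omega\to\mathbb{F}_q$ is an $\mathbb{F}_q$-algebra under convolution $(f*g)(x)=\sum_{y\in\Omega}f(x-y)g(y)$. A cyclic code of length $n$ over $\mathbb{F}_q$ is an ideal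 of this algebra (equivalently, a subspace closed under the cyclic shift). The group $\operatorname{Sym}(\Omega)$ acts on $\mathbb{F}_q^\Omega$ by $(\sigma c)(i)=c(\sigma^{ -1}i)$, and $\operatorname{PAut}(C):=\{\sigma\in\operatorname{Sym}(\Omega):\sigma C=C\}$. -}

module Defs where

open import Algebra.Bundles using (CommutativeRing)
open import Algebra.Definitions using (Invertible)
import Algebra.Properties.Monoid.Sum as Sum
open import Data.Fin.Base using (Fin; toℕ)
open import Data.Fin.Permutation using (Permutation′; _⟨$⟩ʳ_; _⟨$⟩ˡ_)
open import Data.Nat.Base as ℕ using (ℕ; NonZero; _∸_; _^_; _≤_)
open import Data.Nat.DivMod using (_mod_)
open import Data.Nat.Primality using (Prime)
open import Data.Product.Base using (∃; ∃₂; _×_)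
open import Data.Vec.Functional using (Vector)
import Data.Vec.Functional.Relation.Binary.Equality.Setoid as VecEquality
open import Function.Bundles using (Inverse)
open import Level using (Level; 0ℓ; _⊔_; suc)
open import Relation.Binary.Definitions using (_Respects_)
open import Relation.Binary.PropositionalEquality using (_≡_; setoid)
open import Relation.Nullary using (¬_)
open import Relation.Unary using (Pred; _∈_; _≐_)

PrimePower : ℕ → Set
PrimePower q = ∃₂ λ p k → Prime p × 1 ≤ k × q ≡ p ^ k

-- The last field says that the carrier, modulo _≈_, has exactly q elements;
-- in particular _≈_ is decidable, so "nonzero" may be read as ¬ (x ≈ 0#).
record FiniteField (c ℓ : Level) (q : ℕ) : Set (suc (c ⊔ ℓ)) where
  field
    commutativeRing : CommutativeRing c ℓ

  open CommutativeRing commutativeRing public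
    renaming (setoid to ≈-setoid)

  field
    0≉1         : ¬ (0# ≈ 1#)
    invertible  : ∀ x → ¬ (x ≈ 0#) → Invertible _≈_ 1# _*_ x
    enumeration : Inverse ≈-setoid (setoid (Fin q))

-- ℤₙ is represented by Fin n, the residues 0, …, n ∸ 1.

module _ {n : ℕ} .{{_ : NonZero n}} where

  infixl 7 _*ₙ_
  infixl 6 _-ₙ_

  1ₙ : Fin n
  1ₙ = 1 mod n

  _*ₙ_ : Fin n → Fin n → Fin n
  x *ₙ y = (toℕ x ℕ.* toℕ y) mod n

  _-ₙ_ : Fin n → Fin n → Fin n
  x -ₙ y = (toℕ x ℕ.+ (n ∸ toℕ y)) mod n

  -- For a unit u, the subgroup of ℤₙˣ generated by u, i.e. the least set of
  -- residues containing u and closed under the group operations.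
  data ⟨_⟩ (u : Fin n) : Pred (Fin n) 0ℓ where
    generator : u ∈ ⟨ u ⟩
    identity  : 1ₙ ∈ ⟨ u ⟩
    product   : ∀ {x y} → x ∈ ⟨ u ⟩ → y ∈ ⟨ u ⟩ → x *ₙ y ∈ ⟨ u ⟩
    inverse   : ∀ {x y} → x ∈ ⟨ u ⟩ → x *ₙ y ≡ 1ₙ → y ∈ ⟨ u ⟩

  orbit : Pred (Fin n) 0ℓ → Fin n → Pred (Fin n) 0ℓ
  orbit K a b = ∃ λ k → k ∈ K × b ≡ a *ₙ k

-- The colors are subsets of ℤₙ and are compared extensionally, by _≐_.
Coloring : ℕ → Set₁
Coloring n = Fin n → Fin n → Pred (Fin n) 0ℓ

Cyc : ∀ {n} .{{_ : NonZero n}} → Pred (Fin n) 0ℓ → Coloring n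
Cyc K x y = orbit K (y -ₙ x)

Aut : ∀ {n} → Coloring n → Pred (Permutation′ n) 0ℓ
Aut π σ = ∀ x y → π (σ ⟨$⟩ʳ x) (σ ⟨$⟩ʳ y) ≐ π x y

Aut[_,_] : (q n : ℕ) .{{_ : NonZero n}} → Pred (Permutation′ n) 0ℓ
Aut[ q , n ] = Aut (Cyc ⟨ q mod n ⟩)

module Codes {c ℓ : Level} {q : ℕ} (F : FiniteField c ℓ q) where
  open FiniteField F
  open VecEquality ≈-setoid using (_≋_)
  open Sum +-monoid using (sum)

  module _ {n : ℕ} where

    0ᵥ : Vector Carrier n
    0ᵥ _ = 0#

    _+ᵥ_ : Vector Carrier n → Vector Carrier n → Vector Carrier n
    (f +ᵥ g) x = f x + g x

    _·ᵥ_ : Carrier → Vector Carrier n → Vector Carrier n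
    (a ·ᵥ f) x = a * f x

    _⋆_ : .{{_ : NonZero n}} → Vector Carrier n → Vector Carrier n → Vector Carrier n
    (f ⋆ g) x = sum (λ y → f (x -ₙ y) * g y)

  -- Ideals of the (commutative) convolution algebra.
  record CyclicCode (n : ℕ) .{{_ : NonZero n}} (r : Level) : Set (c ⊔ ℓ ⊔ suc r) where
    field
      words     : Pred (Vector Carrier n) r
      resp      : words Respects _≋_
      0-closed  : 0ᵥ ∈ words
      +-closed  : ∀ {f g} → f ∈ words → g ∈ words → (f +ᵥ g) ∈ words
      ·-closed  : ∀ a {f} → f ∈ words → (a ·ᵥ f) ∈ words
      ⋆-closed  : ∀ f {g} → g ∈ words → (f ⋆ g) ∈ words

  act : ∀ {n} → Permutation′ n → Vector Carrier n → Vector Carrier n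
  act σ f i = f (σ ⟨$⟩ˡ i)

  image : ∀ {n r} → Permutation′ n → Pred (Vector Carrier n) r → Pred (Vector Carrier n) (c ⊔ ℓ ⊔ r)
  image σ C g = ∃ λ f → f ∈ C × g ≋ act σ f

  PAut : ∀ {n r} .{{_ : NonZero n}} → CyclicCode n r → Pred (Permutation′ n) (c ⊔ ℓ ⊔ r)
  PAut C σ = image σ (CyclicCode.words C) ≐ CyclicCode.words C

{-# OPTIONS --safe #-}
-- A word f of a cyclic code satisfies f = f ⋆ e with e = f ^ (qᵐ - 1) in the
-- code, where qᵐ ≡ 1 mod n: by Frobenius, f ^ q is f with its argument divided
-- by q.  Moreover e ^ q = e, so e is constant on the orbits of ⟨q⟩ and
-- convolution by e commutes with every automorphism σ of the scheme; hence
-- σ f = σ f ⋆ e stays in the code.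
--
-- Conversely, let b be the indicator function of an orbit.  Since b ^ q = b and
-- x ^ q - x is the product of all x - a with a in the field, convolution by b
-- is diagonalisable.  Its eigenspaces are cyclic codes, so a permutation σ that
-- preserves every code commutes with it, and therefore preserves the orbit.
module Submission where

open import Algebra.Bundles using (AbelianGroup; CommutativeMonoid; CommutativeRing)
import Algebra.Properties.CommutativeMonoid.Sum as CommutativeMonoidSum
open import Data.Bool.Base using (if_then_else_)
open import Data.Fin.Base as Fin using (Fin; toℕ; fromℕ; inject₁; punchIn)
open import Data.Fin.Permutation using (Permutation′; permutation; _⟨$⟩ʳ_; _⟨$⟩ˡ_; inverseʳ; inverseˡ; flip)
import Data.Fin.Properties as Fin
open import Data.List.Base as List using (List; []; _∷_; length; map; tabulate)
open import Data.List.Properties using (length-map; length-tabulate; length-replicate)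
open import Data.List.Relation.Unary.All as All using (All; []; _∷_)
import Data.List.Relation.Unary.All.Properties as All
open import Data.List.Relation.Unary.AllPairs as AllPairs using (AllPairs; []; _∷_)
import Data.List.Relation.Unary.AllPairs.Properties as AllPairs
open import Data.Nat.Base as ℕ using (ℕ; NonZero; zero; suc; _∸_; _≤_; _<_; z<s; s<s; _!; _%_; _/_)
open import Data.Nat.Combinatorics using (_C_; nCn≡1; k![n∸k]!∣n!)
open import Data.Nat.Combinatorics.Specification using (nCk≡n!/k![n-k]!)
open import Data.Nat.Coprimality using (coprime-divisor; gcd≡1⇒coprime)
open import Data.Nat.DivMod using (_mod_; m/n*n≡m; m≡m%n+[m/n]*n; %-distribˡ-+; %-distribˡ-*; m<n⇒m%n≡m; m%n<n; m%n%n≡m%n; n%n≡0; [m+kn]%n≡m%n)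
open import Data.Nat.Divisibility using (_∣_; divides; ∣⇒≤; ∣1⇒≡1; m∣m*n; ∣-refl)
open import Data.Nat.GCD using (gcd)
open import Data.Nat.Primality using (Prime; euclidsLemma; prime⇒nonTrivial; prime⇒nonZero; ¬prime[0]; ¬prime[1])
import Data.Nat.Properties as ℕ
open import Data.Product.Base using (_,_; proj₁; proj₂; ∃)
open import Data.Sum.Base using (inj₁; inj₂)
open import Data.Vec.Functional using (Vector; removeAt; replicate)
import Data.Vec.Functional.Relation.Binary.Equality.Setoid as VecEquality
open import Data.Vec.Functional.Relation.Binary.Pointwise.Properties using (decidable)
open import Function.Base using (_∘_)
open import Function.Bundles using (Inverse)
open import Level using (Level; 0ℓ; _⊔_; Lift; lift; lower)
open import Relation.Binary.Bundles using (Setoid)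
open import Relation.Binary.Core using (_Preserves_⟶_)
open import Relation.Binary.Definitions using (Decidable)
open import Relation.Binary.PropositionalEquality as ≡ using (_≡_; _≢_)
import Relation.Binary.Reasoning.Setoid as SetoidReasoning
open import Relation.Nullary using (¬_; Dec; yes; no; does; contradiction)
open import Relation.Nullary.Decidable using (True; toWitness; fromWitness; map′; dec-true; dec-false)
open import Relation.Unary using (Pred; ⋂; _∈_; _≐_)
open import Defs

-- No extension field with n-th roots of unity is adjoined, so neither characters of ℤₙ nor
-- idempotents built from them are at hand; the identity a ^ q = a in the field replaces both. Read
-- in the group algebra, it says that the q-th power keeps coefficients and multiplies exponents by
-- q, which is why the elements fixed by it are the functions constant on orbits. The splitting of x
-- ^ q - x takes place in the convolution algebra, which in general has zero divisors. It still
-- works there because the roots are scalars, and a difference of distinct scalars is invertible.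
-- Both directions rest on one equivalence. Convolution by b has the matrix with entries b (x - y),
-- so it commutes with σ exactly when b (σ x - σ y) = b (x - y) for all x and y. For b constant on
-- orbits, automorphisms of the scheme satisfy this; for b the indicator of an orbit, it says that σ
-- respects that color.

module _ {a ℓ : Level} (M : CommutativeMonoid a ℓ) where
  open CommutativeMonoid M
  open import Algebra.Properties.CommutativeMonoid.Sum M

  sum-single : ∀ {n} (t : Vector Carrier n) z → (∀ i → i ≢ z → t i ≈ ε) → sum t ≈ t z
  sum-single {suc n} t z t≈ε = begin
    sum t                        ≈⟨ sum-remove {i = z} t ⟩
    t z ∙ sum (removeAt t z)     ≈⟨ ∙-congˡ (sum-cong-≋ (λ j → t≈ε (punchIn z j) (Fin.punchInᵢ≢i z j))) ⟩
    t z ∙ sum (replicate n ε)    ≈⟨ ∙-congˡ (sum-replicate-zero n) ⟩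
    t z ∙ ε                      ≈⟨ identityʳ _ ⟩
    t z                          ∎
    where open import Relation.Binary.Reasoning.Setoid setoid

-- Binomial coefficients modulo a prime, and the Frobenius map

prime∤! : ∀ {p m} → Prime p → m < p → ¬ p ∣ m !
prime∤! {m = zero}  pp _   p∣1 = ¬prime[1] (≡.subst Prime (∣1⇒≡1 p∣1) pp)
prime∤! {m = suc m} pp m<p p∣m! with euclidsLemma (suc m) (m !) pp p∣m!
... | inj₁ p∣1+m = contradiction (∣⇒≤ p∣1+m) (ℕ.<⇒≱ m<p)
... | inj₂ p∣m!′ = prime∤! pp (ℕ.<-trans (ℕ.n<1+n m) m<p) p∣m!′

-- `p` divides p ! = (p C k) * (k ! * (p - k) !), but neither of the two factorials, since `k` and p
-- - k both lie below `p`.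
prime∣C : ∀ {p k} → Prime p → 0 < k → k < p → p ∣ p C k
prime∣C {zero} pp = contradiction pp ¬prime[0]
prime∣C {p@(suc p′)} {k} pp 0<k k<p
  with euclidsLemma (p C k) (k ! ℕ.* (p ∸ k) !) pp (≡.subst (p ∣_) (≡.sym C*k!≡p!) (m∣m*n (p′ !)))
  where
  instance _ = k ℕ.!* (p ∸ k) !≢0
  C*k!≡p! : (p C k) ℕ.* (k ! ℕ.* (p ∸ k) !) ≡ p !
  C*k!≡p! = ≡.trans (≡.cong (ℕ._* (k ! ℕ.* (p ∸ k) !)) (nCk≡n!/k![n-k]! (ℕ.<⇒≤ k<p)))
                    (m/n*n≡m (k![n∸k]!∣n! (ℕ.<⇒≤ k<p)))
... | inj₁ p∣C = p∣C
... | inj₂ p∣k!*[p-k]! with euclidsLemma (k !) ((p ∸ k) !) pp p∣k!*[p-k]!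
...   | inj₁ p∣k!     = contradiction p∣k! (prime∤! pp k<p)
...   | inj₂ p∣[p-k]! = contradiction p∣[p-k]! (prime∤! pp (ℕ.∸-monoʳ-< 0<k (ℕ.<⇒≤ k<p)))

module Frobenius {c ℓ : Level} (R : CommutativeRing c ℓ) where
  open CommutativeRing R hiding (zero)
  open import Algebra.Properties.CommutativeSemiring.Binomial commutativeSemiring
    using (binomialTerm; theorem)
  open import Algebra.Properties.CommutativeSemiring.Exp commutativeSemiring
  open import Algebra.Properties.Semiring.Mult semiring
  open import Algebra.Properties.Semiring.Sum semiring
  open import Relation.Binary.Reasoning.Setoid setoid

  module _ {p : ℕ} (pp : Prime p) (p×1≈0 : p × 1# ≈ 0#) where

    ∣⇒×≈0 : ∀ {m} → p ∣ m → ∀ x → m × x ≈ 0#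
    ∣⇒×≈0 {m} (divides d m≡d*p) x = begin
      m × x                ≈⟨ ×-congˡ m≡d*p ⟩
      (d ℕ.* p) × x        ≈⟨ ×-congʳ (d ℕ.* p) (*-identityˡ x) ⟨
      (d ℕ.* p) × (1# * x) ≈⟨ ×-assocˡ (1# * x) d p ⟨
      d × (p × (1# * x))   ≈⟨ ×-congʳ d (×-assoc-* p 1# x) ⟨
      d × ((p × 1#) * x)   ≈⟨ ×-congʳ d (trans (*-congʳ p×1≈0) (zeroˡ x)) ⟩
      d × 0#               ≈⟨ sum-replicate d ⟨
      sum (replicate d 0#) ≈⟨ sum-replicate-zero d ⟩
      0#                   ∎

    frobenius : ∀ x y → (x + y) ^ p ≈ x ^ p + y ^ p
    frobenius x y = binomial p ≡.refl
      where
      -- The exponent is renamed to `r` so that it can be exposed as a successor: only then do both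
      -- extreme terms, at 0 and at `p`, split off the binomial sum. Those between them vanish.
      binomial : ∀ r → r ≡ p → (x + y) ^ r ≈ x ^ r + y ^ r
      binomial zero    ≡.refl = contradiction pp ¬prime[0]
      binomial (suc r) ≡.refl = begin
        (x + y) ^ p                                   ≈⟨ theorem p x y ⟩
        t Fin.zero + sum (λ i → t (Fin.suc i))        ≈⟨ +-congˡ (sum-init-last (λ i → t (Fin.suc i))) ⟩
        t Fin.zero + (sum (λ i → t (Fin.suc (inject₁ i))) + t (fromℕ p))
                                                      ≈⟨ +-congˡ (+-congʳ (trans (sum-cong-≋ middle) (sum-replicate-zero r))) ⟩
        t Fin.zero + (0# + t (fromℕ p))               ≈⟨ +-congˡ (+-identityˡ _) ⟩
        t Fin.zero + t (fromℕ p)                      ≈⟨ +-cong bottom top ⟩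
        y ^ p + x ^ p                                 ≈⟨ +-comm _ _ ⟩
        x ^ p + y ^ p                                 ∎
        where
        t : Vector Carrier (suc p)
        t = binomialTerm x y p

        middle : ∀ i → t (Fin.suc (inject₁ i)) ≈ 0#
        middle i = ∣⇒×≈0 (prime∣C pp z<s (s<s (≡.subst (_< r) (≡.sym (Fin.toℕ-inject₁ i)) (Fin.toℕ<n i)))) _

        bottom : t Fin.zero ≈ y ^ p
        bottom = trans (×-homo-1 _) (*-identityˡ _)

        top : t (fromℕ p) ≈ x ^ p
        top = begin
          t (fromℕ p)                         ≈⟨ ×-cong (≡.cong (p C_) (Fin.toℕ-fromℕ p)) (*-cong (^-congʳ x (Fin.toℕ-fromℕ p)) (^-congʳ y (≡.trans (≡.cong (p ∸_) (Fin.toℕ-fromℕ p)) (ℕ.n∸n≡0 p)))) ⟩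
          (p C p) × (x ^ p * 1#)              ≈⟨ ×-cong (nCn≡1 p) (*-identityʳ _) ⟩
          1 × (x ^ p)                         ≈⟨ ×-homo-1 _ ⟩
          x ^ p                               ∎

    frobenius-^ : ∀ k x y → (x + y) ^ (p ℕ.^ k) ≈ x ^ (p ℕ.^ k) + y ^ (p ℕ.^ k)
    frobenius-^ zero    x y = trans (*-identityʳ _) (sym (+-cong (*-identityʳ _) (*-identityʳ _)))
    frobenius-^ (suc k) x y = begin
      (x + y) ^ (p ℕ.* pᵏ)                ≈⟨ ^-assocʳ (x + y) p pᵏ ⟨
      ((x + y) ^ p) ^ pᵏ                  ≈⟨ ^-congˡ pᵏ (frobenius x y) ⟩
      (x ^ p + y ^ p) ^ pᵏ                ≈⟨ frobenius-^ k (x ^ p) (y ^ p) ⟩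
      (x ^ p) ^ pᵏ + (y ^ p) ^ pᵏ         ≈⟨ +-cong (^-assocʳ x p pᵏ) (^-assocʳ y p pᵏ) ⟩
      x ^ (p ℕ.* pᵏ) + y ^ (p ℕ.* pᵏ)     ∎
      where pᵏ = p ℕ.^ k

-- Finite fields: the characteristic and the identity x ^ q = x

if-yes : ∀ {a p} {A : Set a} {P : Set p} {x y : A} (P? : Dec P) → P →
         (if does P? then x else y) ≡ x
if-yes P? p rewrite dec-true P? p = ≡.refl

if-no : ∀ {a p} {A : Set a} {P : Set p} {x y : A} (P? : Dec P) → ¬ P →
        (if does P? then x else y) ≡ y
if-no P? ¬p rewrite dec-false P? ¬p = ≡.refl

module FiniteFieldProperties {c ℓ : Level} {q : ℕ} (F : FiniteField c ℓ q) where
  open FiniteField F hiding (zero)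
  open Inverse enumeration using (to; from; to-cong; strictlyInverseˡ; strictlyInverseʳ)
  open import Algebra.Properties.CommutativeSemiring.Exp commutativeSemiring
  open import Algebra.Properties.Semiring.Mult semiring using (×1-homo-*) renaming (_×_ to _×ᵣ_)
  open import Relation.Binary.Reasoning.Setoid ≈-setoid

  to-injective : ∀ {x y} → to x ≡ to y → x ≈ y
  to-injective {x} {y} eq =
    trans (sym (strictlyInverseʳ x)) (trans (reflexive (≡.cong from eq)) (strictlyInverseʳ y))

  infix 4 _≈?_
  _≈?_ : Decidable _≈_
  x ≈? y = map′ to-injective to-cong (to x Fin.≟ to y)

  x≉0∧xy≈0⇒y≈0 : ∀ {x y} → ¬ x ≈ 0# → x * y ≈ 0# → y ≈ 0#
  x≉0∧xy≈0⇒y≈0 {x} {y} x≉0 xy≈0 = begin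
    y              ≈⟨ *-identityˡ y ⟨
    1# * y         ≈⟨ *-congʳ (proj₁ (proj₂ (invertible x x≉0))) ⟨
    x⁻¹ * x * y    ≈⟨ *-assoc x⁻¹ x y ⟩
    x⁻¹ * (x * y)  ≈⟨ *-congˡ xy≈0 ⟩
    x⁻¹ * 0#       ≈⟨ zeroʳ x⁻¹ ⟩
    0#             ∎
    where x⁻¹ = proj₁ (invertible x x≉0)

  x^k≈0⇒x≈0 : ∀ {x} k → x ^ k ≈ 0# → x ≈ 0#
  x^k≈0⇒x≈0     zero    1≈0 = contradiction (sym 1≈0) 0≉1
  x^k≈0⇒x≈0 {x} (suc k) xxᵏ≈0 with x ≈? 0#
  ... | yes x≈0 = x≈0
  ... | no  x≉0 = x^k≈0⇒x≈0 k (x≉0∧xy≈0⇒y≈0 x≉0 xxᵏ≈0)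

  *-cancelʳ : ∀ {x y z} → ¬ z ≈ 0# → x * z ≈ y * z → x ≈ y
  *-cancelʳ {x} {y} {z} z≉0 xz≈yz = begin
    x               ≈⟨ *-identityʳ x ⟨
    x * 1#          ≈⟨ *-congˡ zz⁻¹≈1 ⟨
    x * (z * z⁻¹)   ≈⟨ *-assoc x z z⁻¹ ⟨
    x * z * z⁻¹     ≈⟨ *-congʳ xz≈yz ⟩
    y * z * z⁻¹     ≈⟨ *-assoc y z z⁻¹ ⟩
    y * (z * z⁻¹)   ≈⟨ *-congˡ zz⁻¹≈1 ⟩
    y * 1#          ≈⟨ *-identityʳ y ⟩
    y               ∎
    where
    z⁻¹ = proj₁ (invertible z z≉0)
    zz⁻¹≈1 = proj₂ (proj₂ (invertible z z≉0))

  module _ {m ℓ′ : Level} (M : CommutativeMonoid m ℓ′) where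
    private module M = CommutativeMonoid M
    open CommutativeMonoidSum M using (sum; sum-permute; sum-cong-≋)

    -- Conjugated by the enumeration, the bijection `u` becomes a permutation of the indices, under
    -- which sums are invariant. It serves additively for translations and multiplicatively for
    -- scalings of the field.
    sum-reindex : (f : Carrier → M.Carrier) → f Preserves _≈_ ⟶ M._≈_ →
                  (u v : Carrier → Carrier) → u Preserves _≈_ ⟶ _≈_ → v Preserves _≈_ ⟶ _≈_ →
                  (∀ x → u (v x) ≈ x) → (∀ x → v (u x) ≈ x) →
                  sum (f ∘ from) M.≈ sum (f ∘ u ∘ from)
    sum-reindex f f-cong u v u-cong v-cong uv vu =
      M.trans (sum-permute (f ∘ from) π) (sum-cong-≋ (λ i → f-cong (strictlyInverseʳ (u (from i)))))
      where
      cancel : ∀ u v → u Preserves _≈_ ⟶ _≈_ → (∀ x → u (v x) ≈ x) →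
               ∀ i → to (u (from (to (v (from i))))) ≡ i
      cancel u v u-cong uv i =
        ≡.trans (to-cong (trans (u-cong (strictlyInverseʳ _)) (uv (from i)))) (strictlyInverseˡ i)
      π : Permutation′ q
      π = permutation (to ∘ u ∘ from) (to ∘ v ∘ from) (cancel u v u-cong uv) (cancel v u v-cong vu)

  -- Translation by 1 permutes the field, so the sum S of all elements satisfies S + q · 1 = S.
  q×1≈0 : q ×ᵣ 1# ≈ 0#
  q×1≈0 = identityʳ-unique (sum from) (q ×ᵣ 1#) (begin
    sum from + q ×ᵣ 1#               ≈⟨ +-congˡ (sum-replicate q) ⟨
    sum from + sum (replicate q 1#)  ≈⟨ ∑-distrib-+ from (λ _ → 1#) ⟨
    sum (λ i → from i + 1#)          ≈⟨ sum-reindex +-commutativeMonoid (λ x → x) (λ eq → eq) (_+ 1#) (_- 1#) +-congʳ +-congʳ (λ x → //-rightDividesˡ 1# x) (λ x → //-rightDividesʳ 1# x) ⟨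
    sum from                         ∎)
    where
    open CommutativeMonoidSum +-commutativeMonoid
    open import Algebra.Properties.Group +-group using (//-rightDividesˡ; //-rightDividesʳ; identityʳ-unique)

  -- The image of p ^ k in the field is the k-th power of the image of `p`, and a field has no
  -- nonzero nilpotent.
  p^k≡q⇒p×1≈0 : ∀ {p} k → q ≡ p ℕ.^ k → p ×ᵣ 1# ≈ 0#
  p^k≡q⇒p×1≈0 {p} k q≡pᵏ = x^k≈0⇒x≈0 k (trans (sym (×1-homo-^ k)) (≡.subst (λ r → r ×ᵣ 1# ≈ 0#) q≡pᵏ q×1≈0))
    where
    ×1-homo-^ : ∀ k → (p ℕ.^ k) ×ᵣ 1# ≈ (p ×ᵣ 1#) ^ k
    ×1-homo-^ zero    = +-identityʳ 1#
    ×1-homo-^ (suc k) = trans (×1-homo-* p (p ℕ.^ k)) (*-congˡ (×1-homo-^ k))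

  private
    if0 : Carrier → Carrier → Carrier → Carrier
    if0 x u v = if does (x ≈? 0#) then u else v

    if0-yes : ∀ {x u v} → x ≈ 0# → if0 x u v ≈ u
    if0-yes {x} x≈0 = reflexive (if-yes (x ≈? 0#) x≈0)

    if0-no : ∀ {x u v} → ¬ x ≈ 0# → if0 x u v ≈ v
    if0-no {x} x≉0 = reflexive (if-no (x ≈? 0#) x≉0)

  -- Multiplication by a ≉ 0 permutes the nonzero elements; the factor 0 of
  -- the product over the whole field is replaced by 1.
  x^q≈x : 0 < q → ∀ a → a ^ q ≈ a
  x^q≈x 0<q a with a ≈? 0#
  ... | yes a≈0 = 0^ 0<q
    where
    0^ : ∀ {r} → 0 < r → a ^ r ≈ a
    0^ {suc r} _ = trans (*-congʳ a≈0) (trans (zeroˡ _) (sym a≈0))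
  ... | no  a≉0 = *-cancelʳ (∏≉0 (g ∘ from) (g≉0 ∘ from)) (begin
    a ^ q * ∏ (g ∘ from)                         ≈⟨ *-congʳ (sum-replicate q) ⟨
    ∏ (replicate q a) * ∏ (g ∘ from)             ≈⟨ ∑-distrib-+ (replicate q a) (g ∘ from) ⟨
    ∏ (λ i → a * g (from i))                     ≈⟨ sum-cong-≋ (λ i → split (from i)) ⟩
    ∏ (λ i → k (from i) * g (a * from i))        ≈⟨ ∑-distrib-+ (k ∘ from) (g ∘ (a *_) ∘ from) ⟩
    ∏ (k ∘ from) * ∏ (g ∘ (a *_) ∘ from)         ≈⟨ *-cong ∏k≈a (sym (sum-reindex *-commutativeMonoid g g-cong (a *_) (a⁻¹ *_) *-congˡ *-congˡ (cancel aa⁻¹≈1) (cancel a⁻¹a≈1))) ⟩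
    a * ∏ (g ∘ from)                             ∎)
    where
    open CommutativeMonoidSum *-commutativeMonoid renaming (sum to ∏)
    a⁻¹ = proj₁ (invertible a a≉0)
    a⁻¹a≈1 = proj₁ (proj₂ (invertible a a≉0))
    aa⁻¹≈1 = proj₂ (proj₂ (invertible a a≉0))

    cancel : ∀ {b d} → b * d ≈ 1# → ∀ x → b * (d * x) ≈ x
    cancel bd≈1 x = trans (sym (*-assoc _ _ x)) (trans (*-congʳ bd≈1) (*-identityˡ x))

    -- `g` makes the product run over the nonzero elements. Then a ^ q holds one factor `a` more
    -- than there are nonzero elements; `k` books it at zero, so that `split` is valid at every
    -- point.
    g k : Carrier → Carrier
    g x = if0 x 1# x
    k x = if0 x a 1#

    g≉0 : ∀ x → ¬ g x ≈ 0#
    g≉0 x gx≈0 with x ≈? 0#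
    ... | yes x≈0 = 0≉1 (trans (sym gx≈0) (if0-yes x≈0))
    ... | no x≉0  = x≉0 (trans (sym (if0-no x≉0)) gx≈0)

    g-cong : g Preserves _≈_ ⟶ _≈_
    g-cong {x} {y} x≈y with x ≈? 0#
    ... | yes x≈0 = trans (if0-yes x≈0) (sym (if0-yes (trans (sym x≈y) x≈0)))
    ... | no x≉0  = trans (if0-no x≉0) (trans x≈y (sym (if0-no (λ y≈0 → x≉0 (trans x≈y y≈0)))))

    split : ∀ x → a * g x ≈ k x * g (a * x)
    split x with x ≈? 0#
    ... | yes x≈0 = *-cong (sym (if0-yes x≈0))
                           (trans (if0-yes x≈0) (sym (if0-yes (trans (*-congˡ x≈0) (zeroʳ a)))))
    ... | no x≉0  = trans (*-congˡ (if0-no x≉0)) (sym (trans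
                      (*-cong (if0-no x≉0) (if0-no (λ ax≈0 → x≉0 (x≉0∧xy≈0⇒y≈0 a≉0 ax≈0))))
                      (*-identityˡ _)))

    ∏≉0 : ∀ {n} (t : Vector Carrier n) → (∀ i → ¬ t i ≈ 0#) → ¬ ∏ t ≈ 0#
    ∏≉0 {zero}  t t≉0 1≈0  = 0≉1 (sym 1≈0)
    ∏≉0 {suc n} t t≉0 ∏≈0 = ∏≉0 (t ∘ Fin.suc) (t≉0 ∘ Fin.suc) (x≉0∧xy≈0⇒y≈0 (t≉0 Fin.zero) ∏≈0)

    ∏k≈a : ∏ (k ∘ from) ≈ a
    ∏k≈a = trans
      (sum-single *-commutativeMonoid (k ∘ from) (to 0#)
        (λ i i≢ → if0-no (λ fromi≈0 → i≢ (≡.trans (≡.sym (strictlyInverseˡ i)) (to-cong fromi≈0)))))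
      (if0-yes (strictlyInverseʳ 0#))

-- Residues modulo n, the powers of q and their orbits

%-≡⇒∣∸ : ∀ {a b n} .{{_ : NonZero n}} → a % n ≡ b % n → n ∣ b ∸ a
%-≡⇒∣∸ {a} {b} {n} p = divides (b / n ∸ a / n) (begin
  b ∸ a                                              ≡⟨ cong₂ _∸_ (m≡m%n+[m/n]*n b n) (m≡m%n+[m/n]*n a n) ⟩
  (b % n ℕ.+ b / n ℕ.* n) ∸ (a % n ℕ.+ a / n ℕ.* n)  ≡⟨ cong (λ r → (b % n ℕ.+ b / n ℕ.* n) ∸ (r ℕ.+ a / n ℕ.* n)) p ⟩
  (b % n ℕ.+ b / n ℕ.* n) ∸ (b % n ℕ.+ a / n ℕ.* n)  ≡⟨ ℕ.[m+n]∸[m+o]≡n∸o (b % n) _ _ ⟩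
  b / n ℕ.* n ∸ a / n ℕ.* n                          ≡⟨ ℕ.*-distribʳ-∸ n (b / n) (a / n) ⟨
  (b / n ∸ a / n) ℕ.* n                              ∎)
  where
  open ≡ using (cong; cong₂)
  open ≡.≡-Reasoning

module Residues {n : ℕ} .{{_ : NonZero n}} where

  open ≡ using (refl; sym; trans; cong; cong₂; subst; isEquivalence)

  infix 4 _~_
  -- A record rather than a bare equation of remainders, so that `a` and `b` can be recovered from
  -- the type by unification.
  record _~_ (a b : ℕ) : Set where
    constructor mk~
    field %-≡ : a % n ≡ b % n
  open _~_ public

  ~-setoid : Setoid 0ℓ 0ℓ
  ~-setoid = record
    { _≈_ = _~_
    ; isEquivalence = record
      { refl  = mk~ refl
      ; sym   = mk~ ∘ sym ∘ %-≡
      ; trans = λ p q → mk~ (trans (%-≡ p) (%-≡ q))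
      }
    }
  open Setoid ~-setoid public using () renaming (refl to ~-refl; sym to ~-sym; trans to ~-trans; reflexive to ~-reflexive)
  open SetoidReasoning ~-setoid

  +-cong-~ : ∀ {a b c d} → a ~ b → c ~ d → a ℕ.+ c ~ b ℕ.+ d
  +-cong-~ {a} {b} {c} {d} (mk~ p) (mk~ q) = mk~ (trans (%-distribˡ-+ a c n)
    (trans (cong₂ (λ x y → (x ℕ.+ y) % n) p q) (sym (%-distribˡ-+ b d n))))

  *-cong-~ : ∀ {a b c d} → a ~ b → c ~ d → a ℕ.* c ~ b ℕ.* d
  *-cong-~ {a} {b} {c} {d} (mk~ p) (mk~ q) = mk~ (trans (%-distribˡ-* a c n)
    (trans (cong₂ (λ x y → (x ℕ.* y) % n) p q) (sym (%-distribˡ-* b d n))))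

  ^-cong-~ : ∀ {a b} k → a ~ b → a ℕ.^ k ~ b ℕ.^ k
  ^-cong-~ zero    p = ~-refl
  ^-cong-~ (suc k) p = *-cong-~ p (^-cong-~ k p)

  toℕ-mod : ∀ a → toℕ (a mod n) ~ a
  toℕ-mod a = mk~ (trans (cong (_% n) (Fin.toℕ-fromℕ< (m%n<n a n))) (m%n%n≡m%n a n))

  mod-cong : ∀ {a b} → a ~ b → a mod n ≡ b mod n
  mod-cong {a} {b} (mk~ p) = Fin.fromℕ<-cong (a % n) (b % n) p (m%n<n a n) (m%n<n b n)

  toℕ-injective-~ : ∀ {x y : Fin n} → toℕ x ~ toℕ y → x ≡ y
  toℕ-injective-~ {x} {y} (mk~ p) = Fin.toℕ-injective
    (trans (sym (m<n⇒m%n≡m (Fin.toℕ<n x))) (trans p (m<n⇒m%n≡m (Fin.toℕ<n y))))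

  mod-toℕ : ∀ (x : Fin n) → toℕ x mod n ≡ x
  mod-toℕ x = toℕ-injective-~ (toℕ-mod (toℕ x))

  infixl 6 _+ₙ_
  _+ₙ_ : Fin n → Fin n → Fin n
  x +ₙ y = (toℕ x ℕ.+ toℕ y) mod n

  negₙ : Fin n → Fin n
  negₙ x = (n ∸ toℕ x) mod n

  0ₙ : Fin n
  0ₙ = 0 mod n

  private
    +ₙ-assoc : ∀ x y z → (x +ₙ y) +ₙ z ≡ x +ₙ (y +ₙ z)
    +ₙ-assoc x y z = mod-cong (begin
      toℕ (x +ₙ y) ℕ.+ toℕ z         ≈⟨ +-cong-~ (toℕ-mod _) ~-refl ⟩
      toℕ x ℕ.+ toℕ y ℕ.+ toℕ z      ≡⟨ ℕ.+-assoc (toℕ x) (toℕ y) (toℕ z) ⟩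
      toℕ x ℕ.+ (toℕ y ℕ.+ toℕ z)    ≈⟨ +-cong-~ ~-refl (toℕ-mod _) ⟨
      toℕ x ℕ.+ toℕ (y +ₙ z)         ∎)

    +ₙ-comm : ∀ x y → x +ₙ y ≡ y +ₙ x
    +ₙ-comm x y = cong (_mod n) (ℕ.+-comm (toℕ x) (toℕ y))

    +ₙ-identityˡ : ∀ x → 0ₙ +ₙ x ≡ x
    +ₙ-identityˡ x = trans (mod-cong (+-cong-~ (toℕ-mod 0) ~-refl)) (mod-toℕ x)

    +ₙ-inverseˡ : ∀ x → (negₙ x) +ₙ x ≡ 0ₙ
    +ₙ-inverseˡ x = mod-cong (begin
      toℕ (negₙ x) ℕ.+ toℕ x     ≈⟨ +-cong-~ (toℕ-mod _) ~-refl ⟩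
      (n ∸ toℕ x) ℕ.+ toℕ x    ≡⟨ ℕ.m∸n+n≡m (ℕ.<⇒≤ (Fin.toℕ<n x)) ⟩
      n                        ≈⟨ mk~ (trans (n%n≡0 n) (sym (m<n⇒m%n≡m (ℕ.n≢0⇒n>0 (ℕ.≢-nonZero⁻¹ n))))) ⟩
      0                        ∎)

  +ₙ-abelianGroup : AbelianGroup 0ℓ 0ℓ
  +ₙ-abelianGroup = record
    { _≈_ = _≡_
    ; _∙_ = _+ₙ_
    ; ε   = 0ₙ
    ; _⁻¹ = negₙ
    ; isAbelianGroup = record
      { isGroup = record
        { isMonoid = record
          { isSemigroup = record
            { isMagma = record { isEquivalence = isEquivalence ; ∙-cong = cong₂ _+ₙ_ }
            ; assoc   = +ₙ-assoc
            }
          ; identity = +ₙ-identityˡ , λ x → trans (+ₙ-comm x 0ₙ) (+ₙ-identityˡ x)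
          }
        ; inverse = +ₙ-inverseˡ , λ x → trans (+ₙ-comm x (negₙ x)) (+ₙ-inverseˡ x)
        ; ⁻¹-cong = cong negₙ
        }
      ; comm = +ₙ-comm
      }
    }

  -ₙ≡+ₙ : ∀ x y → x -ₙ y ≡ x +ₙ (negₙ y)
  -ₙ≡+ₙ x y = mod-cong (+-cong-~ ~-refl (~-sym (toℕ-mod _)))

  infixl 7 _·ₙ_
  -- Scaling by an unreduced natural number lets q ^ i act directly and reuses the laws of exponents
  -- in ℕ; `*ₙ-mod` connects it with the product that defines orbits.
  _·ₙ_ : Fin n → ℕ → Fin n
  x ·ₙ r = (toℕ x ℕ.* r) mod n

  ·ₙ-cong : ∀ x {r s} → r ~ s → x ·ₙ r ≡ x ·ₙ s
  ·ₙ-cong x r~s = mod-cong (*-cong-~ {toℕ x} ~-refl r~s)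

  ·ₙ-assoc : ∀ x r s → x ·ₙ r ·ₙ s ≡ x ·ₙ (r ℕ.* s)
  ·ₙ-assoc x r s = mod-cong (~-trans (*-cong-~ (toℕ-mod _) ~-refl) (~-reflexive (ℕ.*-assoc (toℕ x) r s)))

  ·ₙ-identity : ∀ x → x ·ₙ 1 ≡ x
  ·ₙ-identity x = trans (cong (_mod n) (ℕ.*-identityʳ (toℕ x))) (mod-toℕ x)

  ·ₙ-zero : ∀ x → x ·ₙ 0 ≡ 0ₙ
  ·ₙ-zero x = cong (_mod n) (ℕ.*-zeroʳ (toℕ x))

  ·ₙ-suc : ∀ x r → x ·ₙ suc r ≡ x +ₙ x ·ₙ r
  ·ₙ-suc x r = mod-cong (~-trans (~-reflexive (ℕ.*-suc (toℕ x) r)) (+-cong-~ ~-refl (~-sym (toℕ-mod _))))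

  ·ₙ-inverse : ∀ {r s} → r ℕ.* s ~ 1 → ∀ x → x ·ₙ r ·ₙ s ≡ x
  ·ₙ-inverse {r} {s} rs~1 x = trans (·ₙ-assoc x r s) (trans (·ₙ-cong x rs~1) (·ₙ-identity x))

  *ₙ-mod : ∀ x r → x *ₙ (r mod n) ≡ x ·ₙ r
  *ₙ-mod x r = mod-cong (*-cong-~ {toℕ x} ~-refl (toℕ-mod r))

  module _ {q : ℕ} .{{_ : NonZero q}} (gcd≡1 : gcd n q ≡ 1) where

    -- Among the n + 1 powers with exponents 0, ..., n two agree modulo n, and coprimality cancels
    -- the smaller one. The exponent is not claimed to be minimal; it is written `suc m` so that q ^
    -- m is an inverse of q.
    order : ∃ λ m → q ℕ.^ suc m ~ 1
    order with i , j , i<j , qⁱ≡qʲ ← Fin.pigeonhole (ℕ.n<1+n n) (λ i → (q ℕ.^ toℕ i) mod n) =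
      d , ~-trans (~-reflexive (sym (ℕ.m+[n∸m]≡n (ℕ.m^n>0 q (suc d))))) 1+[qᵈ-1]~1
      where
      d = toℕ j ∸ suc (toℕ i)

      cancel : ∀ k {c} → n ∣ q ℕ.^ k ℕ.* c → n ∣ c
      cancel zero    {c} n∣ = subst (n ∣_) (ℕ.*-identityˡ c) n∣
      cancel (suc k) {c} n∣ =
        cancel k (coprime-divisor (gcd≡1⇒coprime gcd≡1) (subst (n ∣_) (ℕ.*-assoc q (q ℕ.^ k) c) n∣))

      qⁱqᵈ≡qʲ : q ℕ.^ toℕ i ℕ.* q ℕ.^ suc d ≡ q ℕ.^ toℕ j
      qⁱqᵈ≡qʲ = trans (sym (ℕ.^-distribˡ-+-* q (toℕ i) (suc d)))
        (cong (q ℕ.^_) (trans (ℕ.+-suc (toℕ i) d) (ℕ.m+[n∸m]≡n i<j)))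

      qⁱ~qʲ : q ℕ.^ toℕ i ~ q ℕ.^ toℕ j
      qⁱ~qʲ = ~-trans (~-sym (toℕ-mod _)) (~-trans (~-reflexive (cong toℕ qⁱ≡qʲ)) (toℕ-mod _))

      n∣qᵈ-1 : n ∣ q ℕ.^ suc d ∸ 1
      n∣qᵈ-1 = cancel (toℕ i) (subst (n ∣_)
        (trans (cong₂ _∸_ (sym qⁱqᵈ≡qʲ) (sym (ℕ.*-identityʳ (q ℕ.^ toℕ i)))) (sym (ℕ.*-distribˡ-∸ (q ℕ.^ toℕ i) (q ℕ.^ suc d) 1)))
        (%-≡⇒∣∸ (%-≡ qⁱ~qʲ)))

      1+[qᵈ-1]~1 : 1 ℕ.+ (q ℕ.^ suc d ∸ 1) ~ 1
      1+[qᵈ-1]~1 with divides k eq ← n∣qᵈ-1 = ~-trans (~-reflexive (cong suc eq)) (mk~ ([m+kn]%n≡m%n 1 k n))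

    private M = suc (proj₁ order)

    q^[k*order]~1 : ∀ k → q ℕ.^ (k ℕ.* M) ~ 1
    q^[k*order]~1 k = begin
      q ℕ.^ (k ℕ.* M)     ≡⟨ cong (q ℕ.^_) (ℕ.*-comm k M) ⟩
      q ℕ.^ (M ℕ.* k)     ≡⟨ ℕ.^-*-assoc q M k ⟨
      (q ℕ.^ M) ℕ.^ k     ≈⟨ ^-cong-~ k (proj₂ order) ⟩
      1 ℕ.^ k             ≡⟨ ℕ.^-zeroˡ k ⟩
      1                   ∎

    q^-mod : ∀ i → q ℕ.^ i ~ q ℕ.^ (i % suc (proj₁ order))
    q^-mod i = begin
      q ℕ.^ i                                        ≡⟨ cong (q ℕ.^_) (m≡m%n+[m/n]*n i M) ⟩
      q ℕ.^ (i % M ℕ.+ i / M ℕ.* M)                  ≡⟨ ℕ.^-distribˡ-+-* q (i % M) (i / M ℕ.* M) ⟩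
      q ℕ.^ (i % M) ℕ.* q ℕ.^ (i / M ℕ.* M)          ≈⟨ *-cong-~ {q ℕ.^ (i % M)} ~-refl (q^[k*order]~1 (i / M)) ⟩
      q ℕ.^ (i % M) ℕ.* 1                            ≡⟨ ℕ.*-identityʳ _ ⟩
      q ℕ.^ (i % M)                                  ∎

    q^-inverse : ∀ i → q ℕ.^ i ℕ.* q ℕ.^ (i ℕ.* proj₁ order) ~ 1
    q^-inverse i = begin
      q ℕ.^ i ℕ.* q ℕ.^ (i ℕ.* proj₁ order)  ≡⟨ ℕ.^-distribˡ-+-* q i _ ⟨
      q ℕ.^ (i ℕ.+ i ℕ.* proj₁ order)        ≡⟨ cong (q ℕ.^_) (ℕ.*-suc i (proj₁ order)) ⟨
      q ℕ.^ (i ℕ.* M)                        ≈⟨ q^[k*order]~1 i ⟩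
      1                                      ∎

    -- Natural exponents suffice because q has finite order: by `q^-inverse` the inverse of q ^ i is
    -- again a power. In the `inverse` case, y is multiplied by this trivial product and regrouped.
    ∈⟨q⟩⇒≡q^ : ∀ {x} → x ∈ ⟨ q mod n ⟩ → ∃ λ i → x ≡ q ℕ.^ i mod n
    ∈⟨q⟩⇒≡q^ generator = 1 , cong (_mod n) (sym (ℕ.*-identityʳ q))
    ∈⟨q⟩⇒≡q^ identity  = 0 , refl
    ∈⟨q⟩⇒≡q^ (product x∈ y∈) with i , refl ← ∈⟨q⟩⇒≡q^ x∈ | j , refl ← ∈⟨q⟩⇒≡q^ y∈ =
      i ℕ.+ j , mod-cong (~-trans (*-cong-~ (toℕ-mod (q ℕ.^ i)) (toℕ-mod (q ℕ.^ j)))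
                                  (~-reflexive (sym (ℕ.^-distribˡ-+-* q i j))))
    ∈⟨q⟩⇒≡q^ (inverse {y = y} x∈ xy≡1) with i , refl ← ∈⟨q⟩⇒≡q^ x∈ =
      i ℕ.* proj₁ order , trans (sym (mod-toℕ y)) (mod-cong (begin
        toℕ y                              ≡⟨ ℕ.*-identityʳ (toℕ y) ⟨
        toℕ y ℕ.* 1                        ≈⟨ *-cong-~ {toℕ y} ~-refl (q^-inverse i) ⟨
        toℕ y ℕ.* (qⁱ ℕ.* qⁱᵐ)             ≡⟨ ℕ.*-assoc (toℕ y) qⁱ qⁱᵐ ⟨
        toℕ y ℕ.* qⁱ ℕ.* qⁱᵐ               ≡⟨ cong (ℕ._* qⁱᵐ) (ℕ.*-comm (toℕ y) qⁱ) ⟩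
        qⁱ ℕ.* toℕ y ℕ.* qⁱᵐ               ≈⟨ *-cong-~ qⁱy~1 ~-refl ⟩
        1 ℕ.* qⁱᵐ                          ≡⟨ ℕ.*-identityˡ qⁱᵐ ⟩
        qⁱᵐ                                ∎))
      where
      qⁱ  = q ℕ.^ i
      qⁱᵐ = q ℕ.^ (i ℕ.* proj₁ order)
      qⁱy~1 : qⁱ ℕ.* toℕ y ~ 1
      qⁱy~1 = begin
        qⁱ ℕ.* toℕ y                        ≈⟨ *-cong-~ (toℕ-mod qⁱ) ~-refl ⟨
        toℕ (qⁱ mod n) ℕ.* toℕ y            ≈⟨ toℕ-mod _ ⟨
        toℕ ((qⁱ mod n) *ₙ y)               ≡⟨ cong toℕ xy≡1 ⟩
        toℕ 1ₙ                              ≈⟨ toℕ-mod 1 ⟩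
        1                                   ∎

    q^∈⟨q⟩ : ∀ i → q ℕ.^ i mod n ∈ ⟨ q mod n ⟩
    q^∈⟨q⟩ zero    = identity
    q^∈⟨q⟩ (suc i) = subst (_∈ ⟨ q mod n ⟩) (mod-cong (*-cong-~ (toℕ-mod q) (toℕ-mod (q ℕ.^ i))))
                           (product generator (q^∈⟨q⟩ i))

    ·q^∈orbit : ∀ x i → x ·ₙ (q ℕ.^ i) ∈ orbit ⟨ q mod n ⟩ x
    ·q^∈orbit x i = q ℕ.^ i mod n , q^∈⟨q⟩ i , sym (*ₙ-mod x (q ℕ.^ i))

    ∈orbit⇒≡·q^ : ∀ x {y} → y ∈ orbit ⟨ q mod n ⟩ x → ∃ λ i → y ≡ x ·ₙ (q ℕ.^ i)
    ∈orbit⇒≡·q^ x (k , k∈ , refl) with i , refl ← ∈⟨q⟩⇒≡q^ k∈ = i , *ₙ-mod x (q ℕ.^ i)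

    -- Exponents only matter modulo the order, which turns the unbounded search for an exponent into
    -- a finite one. This is what makes indicator functions of orbits definable.
    orbit? : ∀ x y → Dec (y ∈ orbit ⟨ q mod n ⟩ x)
    orbit? x y = map′
      (λ (i , eq) → subst (_∈ orbit ⟨ q mod n ⟩ x) (sym eq) (·q^∈orbit x (toℕ i)))
      reduce
      (Fin.any? {n = suc (proj₁ order)} (λ i → y Fin.≟ x ·ₙ (q ℕ.^ toℕ i)))
      where
      reduce : y ∈ orbit ⟨ q mod n ⟩ x → ∃ λ i → y ≡ x ·ₙ (q ℕ.^ toℕ {suc (proj₁ order)} i)
      reduce y∈ with i , eq ← ∈orbit⇒≡·q^ x y∈ =
        Fin.fromℕ< i%M<M ,
        trans eq (·ₙ-cong x (~-trans (q^-mod i) (~-reflexive (cong (q ℕ.^_) (sym (Fin.toℕ-fromℕ< i%M<M))))))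
        where i%M<M = m%n<n i (suc (proj₁ order))

    orbit-refl : ∀ x → x ∈ orbit ⟨ q mod n ⟩ x
    orbit-refl x = subst (_∈ orbit ⟨ q mod n ⟩ x) (·ₙ-identity x) (·q^∈orbit x 0)

    orbit-trans : ∀ x {y z} → y ∈ orbit ⟨ q mod n ⟩ x → z ∈ orbit ⟨ q mod n ⟩ y → z ∈ orbit ⟨ q mod n ⟩ x
    orbit-trans x {y} {z} y∈ z∈ = trans′ (∈orbit⇒≡·q^ x y∈) (∈orbit⇒≡·q^ y z∈)
      where
      trans′ : ∀ {y} → (∃ λ i → y ≡ x ·ₙ (q ℕ.^ i)) → (∃ λ j → z ≡ y ·ₙ (q ℕ.^ j)) → z ∈ orbit ⟨ q mod n ⟩ x
      trans′ (i , refl) (j , refl) = subst (_∈ orbit ⟨ q mod n ⟩ x)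
        (sym (trans (·ₙ-assoc x (q ℕ.^ i) (q ℕ.^ j)) (·ₙ-cong x (~-reflexive (sym (ℕ.^-distribˡ-+-* q i j))))))
        (·q^∈orbit x (i ℕ.+ j))

    orbit-sym : ∀ x {y} → y ∈ orbit ⟨ q mod n ⟩ x → x ∈ orbit ⟨ q mod n ⟩ y
    orbit-sym x y∈ = sym′ (∈orbit⇒≡·q^ x y∈)
      where
      sym′ : ∀ {y} → (∃ λ i → y ≡ x ·ₙ (q ℕ.^ i)) → x ∈ orbit ⟨ q mod n ⟩ y
      sym′ (i , refl) = subst (_∈ orbit ⟨ q mod n ⟩ (x ·ₙ (q ℕ.^ i))) (·ₙ-inverse (q^-inverse i) x)
        (·q^∈orbit (x ·ₙ (q ℕ.^ i)) (i ℕ.* proj₁ order))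

module _ {n : ℕ} .{{_ : NonZero n}} where
  open Residues {n}
  open AbelianGroup +ₙ-abelianGroup using (group; assoc)
  open import Algebra.Properties.Group group using (//-rightDividesˡ; //-rightDividesʳ; ⁻¹-anti-homo-∙; ⁻¹-anti-homo-//)
  open import Algebra.Properties.AbelianGroup +ₙ-abelianGroup using (xyx⁻¹≈y)
  open ≡ using (trans; cong)
  open ≡.≡-Reasoning

  [x-y]+y≡x : ∀ x y → x -ₙ y +ₙ y ≡ x
  [x-y]+y≡x x y = trans (cong (_+ₙ y) (-ₙ≡+ₙ x y)) (//-rightDividesˡ y x)

  [x+y]-y≡x : ∀ x y → x +ₙ y -ₙ y ≡ x
  [x+y]-y≡x x y = trans (-ₙ≡+ₙ (x +ₙ y) y) (//-rightDividesʳ y x)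

  x-[x-y]≡y : ∀ x y → x -ₙ (x -ₙ y) ≡ y
  x-[x-y]≡y x y = begin
    x -ₙ (x -ₙ y)                ≡⟨ -ₙ≡+ₙ x (x -ₙ y) ⟩
    x +ₙ negₙ (x -ₙ y)           ≡⟨ cong (λ z → x +ₙ negₙ z) (-ₙ≡+ₙ x y) ⟩
    x +ₙ negₙ (x +ₙ negₙ y)      ≡⟨ cong (x +ₙ_) (⁻¹-anti-homo-// x y) ⟩
    x +ₙ (y +ₙ negₙ x)           ≡⟨ assoc x y (negₙ x) ⟨
    x +ₙ y +ₙ negₙ x             ≡⟨ xyx⁻¹≈y x y ⟩
    y                            ∎

  x-y-z≡x-[z+y] : ∀ x y z → x -ₙ y -ₙ z ≡ x -ₙ (z +ₙ y)
  x-y-z≡x-[z+y] x y z = begin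
    x -ₙ y -ₙ z                  ≡⟨ -ₙ≡+ₙ (x -ₙ y) z ⟩
    x -ₙ y +ₙ negₙ z             ≡⟨ cong (_+ₙ negₙ z) (-ₙ≡+ₙ x y) ⟩
    x +ₙ negₙ y +ₙ negₙ z        ≡⟨ assoc x (negₙ y) (negₙ z) ⟩
    x +ₙ (negₙ y +ₙ negₙ z)      ≡⟨ cong (x +ₙ_) (⁻¹-anti-homo-∙ z y) ⟨
    x +ₙ negₙ (z +ₙ y)           ≡⟨ -ₙ≡+ₙ x (z +ₙ y) ⟨
    x -ₙ (z +ₙ y)                ∎

  x-0≡x : ∀ x → x -ₙ 0ₙ ≡ x
  x-0≡x x = begin
    x -ₙ 0ₙ          ≡⟨ cong (_-ₙ 0ₙ) (AbelianGroup.identityʳ +ₙ-abelianGroup x) ⟨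
    x +ₙ 0ₙ -ₙ 0ₙ    ≡⟨ [x+y]-y≡x x 0ₙ ⟩
    x                ∎

-- Monic polynomials over a commutative ring and their splitting

module MonicPolynomials {c ℓ : Level} (R : CommutativeRing c ℓ) where
  open CommutativeRing R hiding (zero)
  open import Algebra.Properties.AbelianGroup +-abelianGroup using (//-rightDividesʳ)
  open import Algebra.Properties.Ring ring using ([y-z]x≈yx-zx; -1*x≈-x)
  open import Algebra.Properties.Semiring.Exp semiring using (_^_)
  open import Algebra.Solver.Ring.NaturalCoefficients.Default commutativeSemiring
  open import Relation.Binary.Reasoning.Setoid setoid

  -- The list holds the coefficients below the leading one, lowest first.
  monic : List Carrier → Carrier → Carrier
  monic []       x = 1#
  monic (a ∷ as) x = a + x * monic as x

  -- Synthetic division by x - r: the quotient's coefficients are the values at `r` of the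
  -- successive tails in Horner's scheme. A polynomial of degree one leaves the quotient 1, which is
  -- the empty list.
  deflate : Carrier → List Carrier → List Carrier
  deflate r []               = []
  deflate r (a ∷ [])         = []
  deflate r (a ∷ as@(_ ∷ _)) = monic as r ∷ deflate r as

  length-deflate : ∀ r a as → length (deflate r (a ∷ as)) ≡ length as
  length-deflate r a []       = ≡.refl
  length-deflate r a (b ∷ as) = ≡.cong suc (length-deflate r b as)

  -- Both sides are moved so that no subtraction occurs.
  monic-divide : ∀ r a as x → let D = monic (deflate r (a ∷ as)) x in
                 monic (a ∷ as) x + r * D ≈ x * D + monic (a ∷ as) r
  monic-divide r a []         x =
    solve 3 (λ a r x → a :+ x :* con 1 :+ r :* con 1 := x :* con 1 :+ (a :+ r :* con 1)) refl a r x
  monic-divide r a as@(b ∷ bs) x = begin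
    a + x * P + r * (ρ + x * D)     ≈⟨ solve 6 (λ a r x P ρ D → a :+ x :* P :+ r :* (ρ :+ x :* D) := x :* (P :+ r :* D) :+ (a :+ r :* ρ)) refl a r x P ρ D ⟩
    x * (P + r * D) + (a + r * ρ)   ≈⟨ +-congʳ (*-congˡ (monic-divide r b bs x)) ⟩
    x * (x * D + ρ) + (a + r * ρ)   ≈⟨ +-congʳ (*-congˡ (+-comm (x * D) ρ)) ⟩
    x * (ρ + x * D) + (a + r * ρ)   ∎
    where
    P = monic as x
    ρ = monic as r
    D = monic (deflate r as) x

  monic-factor : ∀ r a as → monic (a ∷ as) r ≈ 0# →
                 ∀ x → monic (a ∷ as) x ≈ (x - r) * monic (deflate r (a ∷ as)) x
  monic-factor r a as root x = begin
    P                   ≈⟨ //-rightDividesʳ (r * D) P ⟨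
    P + r * D - r * D   ≈⟨ +-congʳ (trans (monic-divide r a as x) (trans (+-congˡ root) (+-identityʳ (x * D)))) ⟩
    x * D - r * D       ≈⟨ [y-z]x≈yx-zx D x r ⟨
    (x - r) * D         ∎
    where
    P = monic (a ∷ as) x
    D = monic (deflate r (a ∷ as)) x

  linearFactors : List Carrier → Carrier → Carrier
  linearFactors []       x = 1#
  linearFactors (r ∷ rs) x = (x - r) * linearFactors rs x

  -- With zero divisors around, a polynomial need not split along distinct roots; the differences of
  -- the roots must not be zero divisors.
  Cancellable : Pred Carrier (c ⊔ ℓ)
  Cancellable d = ∀ z → d * z ≈ 0# → z ≈ 0#

  -- Dividing by x - r keeps every other root s: the quotient D satisfies (s - r) * D(s) = 0, and s
  -- - r cancels.
  monic≈linearFactors : ∀ as rs → length as ≡ length rs →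
                        AllPairs (λ r s → Cancellable (s - r)) rs → All (λ r → monic as r ≈ 0#) rs →
                        ∀ x → monic as x ≈ linearFactors rs x
  monic≈linearFactors []       []       _  _              _              x = refl
  monic≈linearFactors (a ∷ as) (r ∷ rs) eq (r≉rs ∷ rs≉rs) (root ∷ roots) x =
    trans (monic-factor r a as root x) (*-congˡ (monic≈linearFactors (deflate r (a ∷ as)) rs
      (≡.trans (length-deflate r a as) (ℕ.suc-injective eq)) rs≉rs
      (All.zipWith (λ { {s} (cancel , root-s) → cancel _ (trans (sym (monic-factor r a as root s)) root-s) }) (r≉rs , roots)) x))

  -- The lower coefficients of x ^ (2 + k) - x.
  x^2+k-x : ℕ → List Carrier
  x^2+k-x k = 0# ∷ - 1# ∷ List.replicate k 0#

  monic-replicate : ∀ k x → monic (List.replicate k 0#) x ≈ x ^ k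
  monic-replicate zero    x = refl
  monic-replicate (suc k) x = trans (+-identityˡ _) (*-congˡ (monic-replicate k x))

  x^2+k≈x⇒root : ∀ k {x} → x ^ (2 ℕ.+ k) ≈ x → monic (x^2+k-x k) x ≈ 0#
  x^2+k≈x⇒root k {x} eq = begin
    0# + x * (- 1# + x * monic (List.replicate k 0#) x)  ≈⟨ +-identityˡ _ ⟩
    x * (- 1# + x * monic (List.replicate k 0#) x)       ≈⟨ *-congˡ (+-congˡ (*-congˡ (monic-replicate k x))) ⟩
    x * (- 1# + x ^ (1 ℕ.+ k))                      ≈⟨ distribˡ x (- 1#) _ ⟩
    x * - 1# + x ^ (2 ℕ.+ k)                        ≈⟨ +-cong (trans (*-comm x (- 1#)) (-1*x≈-x x)) eq ⟩
    - x + x                                         ≈⟨ -‿inverseˡ x ⟩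
    0#                                              ∎

-- The convolution algebra and its q-th power map

module Convolution {c ℓ : Level} {q : ℕ} (F : FiniteField c ℓ q) {n : ℕ} .{{_ : NonZero n}} where
  open FiniteField F hiding (zero)
  open Codes F
  open Residues {n}
  open FiniteFieldProperties F using (p^k≡q⇒p×1≈0; x^q≈x)
  open VecEquality ≈-setoid using (_≋_; ≋-isEquivalence)
  open import Algebra.Properties.Semiring.Sum semiring
  open import Algebra.Properties.Semiring.Exp semiring using (_^_)
  open import Algebra.Properties.Monoid.Mult +-monoid using () renaming (_×_ to _×ᵣ_)
  open import Relation.Binary.Reasoning.Setoid ≈-setoid

  shift reflect : Fin n → Permutation′ n
  shift   y = permutation (_+ₙ y) (_-ₙ y) (λ x → [x-y]+y≡x x y) (λ x → [x+y]-y≡x x y)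
  reflect x = permutation (x -ₙ_) (x -ₙ_) (x-[x-y]≡y x) (x-[x-y]≡y x)

  -- The monomial a X^z of the group algebra of ℤₙ, whose product is convolution.
  single : Fin n → Carrier → Vector Carrier n
  single z a x = if does (x Fin.≟ z) then a else 0#

  single-yes : ∀ x z {a} → x ≡ z → single z a x ≈ a
  single-yes x z x≡z = reflexive (if-yes (x Fin.≟ z) x≡z)

  single-no : ∀ x z {a} → x ≢ z → single z a x ≈ 0#
  single-no x z x≢z = reflexive (if-no (x Fin.≟ z) x≢z)

  single-cong : ∀ z {a b} → a ≈ b → single z a ≋ single z b
  single-cong z a≈b x with x Fin.≟ z
  ... | yes _ = a≈b
  ... | no  _ = refl

  ⋆-single : ∀ f z a x → (f ⋆ single z a) x ≈ f (x -ₙ z) * a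
  ⋆-single f z a x = trans
    (sum-single +-commutativeMonoid (λ y → f (x -ₙ y) * single z a y) z
      (λ y y≢z → trans (*-congˡ (single-no y z y≢z)) (zeroʳ _)))
    (*-congˡ (single-yes z z ≡.refl))

  ⋆-cong : ∀ {f f′ g g′} → f ≋ f′ → g ≋ g′ → (f ⋆ g) ≋ (f′ ⋆ g′)
  ⋆-cong f≋f′ g≋g′ x = sum-cong-≋ (λ y → *-cong (f≋f′ (x -ₙ y)) (g≋g′ y))

  ⋆-comm : ∀ f g → (f ⋆ g) ≋ (g ⋆ f)
  ⋆-comm f g x = begin
    sum (λ y → f (x -ₙ y) * g y)                    ≈⟨ sum-permute _ (reflect x) ⟩
    sum (λ y → f (x -ₙ (x -ₙ y)) * g (x -ₙ y))      ≈⟨ sum-cong-≋ (λ y → trans (*-congʳ {g (x -ₙ y)} (reflexive (≡.cong f (x-[x-y]≡y x y)))) (*-comm _ _)) ⟩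
    sum (λ y → g (x -ₙ y) * f y)                    ∎

  ⋆-assoc : ∀ f g h → ((f ⋆ g) ⋆ h) ≋ (f ⋆ (g ⋆ h))
  ⋆-assoc f g h x = begin
    sum (λ y → sum (λ z → f (x -ₙ y -ₙ z) * g z) * h y)
      ≈⟨ sum-cong-≋ {n} (λ y → *-distribʳ-sum (h y) (λ z → f (x -ₙ y -ₙ z) * g z)) ⟩
    sum (λ y → sum (λ z → f (x -ₙ y -ₙ z) * g z * h y))
      ≈⟨ sum-cong-≋ {n} (λ y → sum-cong-≋ {n} (λ z → trans (*-assoc _ _ _)
           (reflexive (≡.cong₂ (λ u v → f u * (g v * h y)) (x-y-z≡x-[z+y] x y z) (≡.sym ([x+y]-y≡x z y)))))) ⟩
    sum (λ y → sum (λ z → f (x -ₙ (z +ₙ y)) * (g (z +ₙ y -ₙ y) * h y)))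
      -- Substitution w = z + y in the inner sum, read from right to left; the previous step wrote
      -- `z` as (z + y) - y to prepare it.
      ≈⟨ sum-cong-≋ {n} (λ y → sum-permute (λ w → f (x -ₙ w) * (g (w -ₙ y) * h y)) (shift y)) ⟨
    sum (λ y → sum (λ w → f (x -ₙ w) * (g (w -ₙ y) * h y)))
      ≈⟨ ∑-comm (λ y w → f (x -ₙ w) * (g (w -ₙ y) * h y)) ⟩
    sum (λ w → sum (λ y → f (x -ₙ w) * (g (w -ₙ y) * h y)))
      ≈⟨ sum-cong-≋ {n} (λ w → *-distribˡ-sum (f (x -ₙ w)) (λ y → g (w -ₙ y) * h y)) ⟨
    sum (λ w → f (x -ₙ w) * sum (λ y → g (w -ₙ y) * h y))
      ∎

  ⋆-identityʳ : ∀ f → (f ⋆ single 0ₙ 1#) ≋ f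
  ⋆-identityʳ f x = begin
    (f ⋆ single 0ₙ 1#) x   ≈⟨ ⋆-single f 0ₙ 1# x ⟩
    f (x -ₙ 0ₙ) * 1#       ≈⟨ *-identityʳ _ ⟩
    f (x -ₙ 0ₙ)            ≡⟨ ≡.cong f (x-0≡x x) ⟩
    f x                    ∎

  ⋆-distribʳ : ∀ f g h → ((g +ᵥ h) ⋆ f) ≋ ((g ⋆ f) +ᵥ (h ⋆ f))
  ⋆-distribʳ f g h x = trans (sum-cong-≋ {n} (λ y → distribʳ (f y) (g (x -ₙ y)) (h (x -ₙ y))))
                             (∑-distrib-+ (λ y → g (x -ₙ y) * f y) (λ y → h (x -ₙ y) * f y))

  convolutionRing : CommutativeRing c ℓ
  convolutionRing = record
    { Carrier = Vector Carrier n
    ; _≈_ = _≋_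
    ; _+_ = _+ᵥ_
    ; _*_ = _⋆_
    ; -_  = λ f x → - f x
    ; 0#  = 0ᵥ
    ; 1#  = single 0ₙ 1#
    ; isCommutativeRing = record
      { isRing = record
        { +-isAbelianGroup = record
          { isGroup = record
            { isMonoid = record
              { isSemigroup = record
                { isMagma = record
                  { isEquivalence = ≋-isEquivalence n
                  ; ∙-cong = λ f≋f′ g≋g′ x → +-cong (f≋f′ x) (g≋g′ x)
                  }
                ; assoc = λ f g h x → +-assoc (f x) (g x) (h x)
                }
              ; identity = (λ f x → +-identityˡ (f x)) , (λ f x → +-identityʳ (f x))
              }
            ; inverse = (λ f x → -‿inverseˡ (f x)) , (λ f x → -‿inverseʳ (f x))
            ; ⁻¹-cong = λ f≋g x → -‿cong (f≋g x)
            }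
          ; comm = λ f g x → +-comm (f x) (g x)
          }
        ; *-cong = ⋆-cong
        ; *-assoc = ⋆-assoc
        ; *-identity = (λ f x → trans (⋆-comm (single 0ₙ 1#) f x) (⋆-identityʳ f x)) , ⋆-identityʳ
        ; distrib = (λ f g h x → trans (⋆-comm f (g +ᵥ h) x) (trans (⋆-distribʳ f g h x) (+-cong (⋆-comm g f x) (⋆-comm h f x))))
                  , ⋆-distribʳ
        }
      ; *-comm = ⋆-comm
      }
    }

  module A = CommutativeRing convolutionRing
  open import Algebra.Properties.CommutativeSemiring.Exp A.commutativeSemiring public using ()
    renaming (_^_ to infixr 8 _^ᵥ_; ^-congˡ to ^ᵥ-congˡ)
  open import Algebra.Properties.Semiring.Sum A.semiring using () renaming (sum to sumᵥ; sum-cong-≋ to sumᵥ-cong)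
  open import Algebra.Properties.Monoid.Mult A.+-monoid using () renaming (_×_ to _×ᵥ_)

  single-⋆-single : ∀ y z a b → (single y a ⋆ single z b) ≋ single (y +ₙ z) (a * b)
  single-⋆-single y z a b x = trans (⋆-single (single y a) z b x) shifted
    where
    shifted : single y a (x -ₙ z) * b ≈ single (y +ₙ z) (a * b) x
    shifted with x Fin.≟ y +ₙ z
    ... | yes x≡y+z = *-congʳ (single-yes (x -ₙ z) y (≡.trans (≡.cong (_-ₙ z) x≡y+z) ([x+y]-y≡x y z)))
    ... | no  x≢y+z = trans (*-congʳ (single-no (x -ₙ z) y (λ x-z≡y → x≢y+z (≡.trans (≡.sym ([x-y]+y≡x x z)) (≡.cong (_+ₙ z) x-z≡y))))) (zeroˡ b)

  single-^ : ∀ y a j → (single y a ^ᵥ j) ≋ single (y ·ₙ j) (a ^ j)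
  single-^ y a zero    x = reflexive (≡.cong (λ z → single z 1# x) (≡.sym (·ₙ-zero y)))
  single-^ y a (suc j) x = begin
    (single y a ⋆ (single y a ^ᵥ j)) x             ≈⟨ A.*-congˡ {single y a} (single-^ y a j) x ⟩
    (single y a ⋆ single (y ·ₙ j) (a ^ j)) x       ≈⟨ single-⋆-single y (y ·ₙ j) a (a ^ j) x ⟩
    single (y +ₙ y ·ₙ j) (a * a ^ j) x             ≡⟨ ≡.cong (λ z → single z (a * a ^ j) x) (·ₙ-suc y j) ⟨
    single (y ·ₙ suc j) (a ^ suc j) x              ∎

  sumᵥ-pointwise : ∀ {m} (t : Vector (Vector Carrier n) m) x → sumᵥ t x ≈ sum (λ i → t i x)
  sumᵥ-pointwise {zero}  t x = refl
  sumᵥ-pointwise {suc m} t x = +-congˡ (sumᵥ-pointwise (t ∘ Fin.suc) x)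

  ×ᵥ-pointwise : ∀ m f x → (m ×ᵥ f) x ≈ m ×ᵣ f x
  ×ᵥ-pointwise zero    f x = refl
  ×ᵥ-pointwise (suc m) f x = +-congˡ (×ᵥ-pointwise m f x)

  ≋∑single : ∀ f → f ≋ sumᵥ (λ z → single z (f z))
  ≋∑single f x = sym (begin
    sumᵥ (λ z → single z (f z)) x   ≈⟨ sumᵥ-pointwise (λ z → single z (f z)) x ⟩
    sum (λ z → single z (f z) x)    ≈⟨ sum-single +-commutativeMonoid (λ z → single z (f z) x) x (λ z z≢x → single-no x z (z≢x ∘ ≡.sym)) ⟩
    single x (f x) x                ≈⟨ single-yes x x ≡.refl ⟩
    f x                             ∎)

  record Additive (φ : Vector Carrier n → Vector Carrier n) : Set (c ⊔ ℓ) where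
    field
      φ-cong : ∀ {f g} → f ≋ g → φ f ≋ φ g
      φ-0    : φ 0ᵥ ≋ 0ᵥ
      φ-+    : ∀ f g → φ (f +ᵥ g) ≋ (φ f +ᵥ φ g)

    φ-sum : ∀ {m} (t : Vector (Vector Carrier n) m) → φ (sumᵥ t) ≋ sumᵥ (φ ∘ t)
    φ-sum {zero}  t = φ-0
    φ-sum {suc m} t = A.trans (φ-+ _ _) (A.+-congˡ (φ-sum (t ∘ Fin.suc)))

  -- Every f is the sum of its monomials, coefficients included, so additivity alone carries the
  -- agreement from monomials to f.
  additive-ext : ∀ {φ ψ} → Additive φ → Additive ψ →
                 (∀ z a → φ (single z a) ≋ ψ (single z a)) → ∀ f → φ f ≋ ψ f
  additive-ext {φ} {ψ} Φ Ψ φ≋ψ f =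
    A.trans (Φ.φ-cong (≋∑single f)) (A.trans (Φ.φ-sum (λ z → single z (f z))) (A.trans (sumᵥ-cong (λ z → φ≋ψ z (f z)))
      (A.trans (A.sym (Ψ.φ-sum (λ z → single z (f z)))) (Ψ.φ-cong (A.sym (≋∑single f))))))
    where
    module Φ = Additive Φ
    module Ψ = Additive Ψ

  module _ {p k : ℕ} (pp : Prime p) (q≡pᵏ : q ≡ p ℕ.^ k) (0<q : 0 < q) where

    p×1ᵥ≋0 : (p ×ᵥ A.1#) ≋ 0ᵥ
    p×1ᵥ≋0 x = trans (×ᵥ-pointwise p A.1# x) (Frobenius.∣⇒×≈0 commutativeRing pp (p^k≡q⇒p×1≈0 k q≡pᵏ) ∣-refl (A.1# x))

    ^q-+ : ∀ f g → ((f +ᵥ g) ^ᵥ q) ≋ ((f ^ᵥ q) +ᵥ (g ^ᵥ q))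
    ^q-+ f g = ≡.subst (λ r → ((f +ᵥ g) ^ᵥ r) ≋ ((f ^ᵥ r) +ᵥ (g ^ᵥ r))) (≡.sym q≡pᵏ)
                       (Frobenius.frobenius-^ convolutionRing pp p×1ᵥ≋0 k f g)

    -- f ^ q is f with its argument divided by q: both sides are additive in f
    -- and agree on the functions supported at one point.
    ^q≋rescale : ∀ {q′} → q′ ℕ.* q ~ 1 → ∀ f → (f ^ᵥ q) ≋ (λ x → f (x ·ₙ q′))
    ^q≋rescale {q′} q′q~1 = additive-ext
      (record { φ-cong = ^ᵥ-congˡ q ; φ-0 = 0^ 0<q ; φ-+ = ^q-+ })
      (record { φ-cong = λ f≋g x → f≋g (x ·ₙ q′) ; φ-0 = λ _ → refl ; φ-+ = λ _ _ _ → refl })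
      on-single
      where
      0^ : ∀ {r} → 0 < r → (0ᵥ ^ᵥ r) ≋ 0ᵥ
      0^ {suc r} _ = A.zeroˡ (0ᵥ ^ᵥ r)

      -- The power moves the monomial from z to z q and turns its coefficient into a ^ q, which is
      -- `a` again in this field.
      on-single : ∀ z a → (single z a ^ᵥ q) ≋ (λ x → single z a (x ·ₙ q′))
      on-single z a x = trans (single-^ z a q x) support
        where
        support : single (z ·ₙ q) (a ^ q) x ≈ single z a (x ·ₙ q′)
        support with x ·ₙ q′ Fin.≟ z
        ... | yes ≡.refl = trans (single-yes x (z ·ₙ q) (≡.sym (·ₙ-inverse q′q~1 x))) (x^q≈x 0<q a)
        ... | no  xq′≢z = single-no x (z ·ₙ q) (λ x≡zq → xq′≢z
          (≡.trans (≡.cong (_·ₙ q′) x≡zq) (·ₙ-inverse (~-trans (~-reflexive (ℕ.*-comm q q′)) q′q~1) z)))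

  -- The matrix with entries b (x - y) is unchanged when σ permutes rows and columns simultaneously,
  -- hence it commutes with the permutation matrix of σ. In the sum this is the substitution y = σ
  -- z.
  act-⋆ : ∀ (σ : Permutation′ n) b → (∀ x y → b ((σ ⟨$⟩ʳ x) -ₙ (σ ⟨$⟩ʳ y)) ≈ b (x -ₙ y)) →
          ∀ f → act σ (b ⋆ f) ≋ (b ⋆ act σ f)
  act-⋆ σ b b-inv f x = begin
    sum (λ z → b (σ⁻¹x -ₙ z) * f z)
      ≈⟨ sum-cong-≋ {n} (λ z → *-cong (b-σ z) (reflexive (≡.cong f (≡.sym (inverseˡ σ))))) ⟩
    sum (λ z → b (x -ₙ (σ ⟨$⟩ʳ z)) * f (σ ⟨$⟩ˡ (σ ⟨$⟩ʳ z)))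
      ≈⟨ sum-permute (λ y → b (x -ₙ y) * f (σ ⟨$⟩ˡ y)) σ ⟨
    sum (λ y → b (x -ₙ y) * f (σ ⟨$⟩ˡ y))
      ∎
    where
    σ⁻¹x = σ ⟨$⟩ˡ x
    b-σ : ∀ z → b (σ⁻¹x -ₙ z) ≈ b (x -ₙ (σ ⟨$⟩ʳ z))
    b-σ z = trans (sym (b-inv σ⁻¹x z)) (reflexive (≡.cong (λ w → b (w -ₙ (σ ⟨$⟩ʳ z))) (inverseʳ σ)))

  -- Apply the hypothesis to the function supported at y.
  act-⋆⁻¹ : ∀ (σ : Permutation′ n) b → (∀ f → act σ (b ⋆ f) ≋ (b ⋆ act σ f)) →
            ∀ x y → b ((σ ⟨$⟩ʳ x) -ₙ (σ ⟨$⟩ʳ y)) ≈ b (x -ₙ y)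
  act-⋆⁻¹ σ b comm x y = begin
    b (σx -ₙ σy)                          ≈⟨ *-identityʳ _ ⟨
    b (σx -ₙ σy) * 1#                     ≈⟨ ⋆-single b σy 1# σx ⟨
    (b ⋆ single σy 1#) σx                 ≈⟨ A.*-congˡ {b} act-single σx ⟨
    (b ⋆ act σ (single y 1#)) σx          ≈⟨ comm (single y 1#) σx ⟨
    (b ⋆ single y 1#) (σ ⟨$⟩ˡ σx)         ≡⟨ ≡.cong (b ⋆ single y 1#) (inverseˡ σ) ⟩
    (b ⋆ single y 1#) x                   ≈⟨ ⋆-single b y 1# x ⟩
    b (x -ₙ y) * 1#                       ≈⟨ *-identityʳ _ ⟩
    b (x -ₙ y)                            ∎
    where
    σx = σ ⟨$⟩ʳ x
    σy = σ ⟨$⟩ʳ y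
    act-single : act σ (single y 1#) ≋ single σy 1#
    act-single z with z Fin.≟ σy
    ... | yes ≡.refl = single-yes (σ ⟨$⟩ˡ σy) y (inverseˡ σ)
    ... | no  z≢σy   = single-no (σ ⟨$⟩ˡ z) y (λ σ⁻¹z≡y → z≢σy (≡.trans (≡.sym (inverseʳ σ)) (≡.cong (σ ⟨$⟩ʳ_) σ⁻¹z≡y)))

-- Eigenspaces of q-fixed elements, and annihilators as codes

module Intersection {c ℓ : Level} {q : ℕ} (F : FiniteField c ℓ q) {n : ℕ} .{{_ : NonZero n}} where
  open FiniteField F hiding (zero)
  open Inverse enumeration using (from; to-cong; strictlyInverseˡ)
  open Codes F
  open Residues {n}
  open Convolution F {n}
  open FiniteFieldProperties F using (_≈?_; x≉0∧xy≈0⇒y≈0; x^q≈x)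
  open MonicPolynomials convolutionRing
  open VecEquality ≈-setoid using (_≋_)
  open import Algebra.Properties.Semiring.Exp semiring using (_^_)
  open import Algebra.Properties.Ring ring using ([y-z]x≈yx-zx; x[y-z]≈xy-xz; -‿distribˡ-*)
  open import Algebra.Properties.Ring A.ring using () renaming ([y-z]x≈yx-zx to [g-h]f≋gf-hf)
  open import Algebra.Properties.AbelianGroup +-abelianGroup
    using (⁻¹-anti-homo-//; \\-leftDividesʳ; x∙y⁻¹≈ε⇒x≈y)
  open import Algebra.Properties.AbelianGroup A.+-abelianGroup
    using () renaming (x∙y⁻¹≈ε⇒x≈y to f-g≋0⇒f≋g)
  open import Algebra.Properties.CommutativeSemigroup A.*-commutativeSemigroup using (x∙yz≈y∙xz; xy∙z≈y∙xz)

  -- The embedding of the scalars: `a` times the unit of convolution.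
  ι : Carrier → Vector Carrier n
  ι = single 0ₙ

  ι-⋆ : ∀ a f → (ι a ⋆ f) ≋ (a ·ᵥ f)
  ι-⋆ a f x = trans (⋆-comm (ι a) f x) (trans (⋆-single f 0ₙ a x)
    (trans (*-congʳ (reflexive (≡.cong f (x-0≡x x)))) (*-comm (f x) a)))

  ι-^ : ∀ {a} m → a ^ m ≈ a → (ι a ^ᵥ m) ≋ ι a
  ι-^ {a} m aᵐ≈a x = trans (single-^ 0ₙ a m x) (trans
    (reflexive (≡.cong (λ z → single z (a ^ m) x) (mod-cong {toℕ 0ₙ ℕ.* m} (*-cong-~ (toℕ-mod 0) ~-refl))))
    (single-cong 0ₙ aᵐ≈a x))

  [g-ι]⋆ : ∀ g a f → ((g A.- ι a) ⋆ f) ≋ ((g ⋆ f) A.- (a ·ᵥ f))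
  [g-ι]⋆ g a f = A.trans ([g-h]f≋gf-hf f g (ι a)) (λ x → +-congˡ (-‿cong (ι-⋆ a f x)))

  elements : List Carrier
  elements = tabulate from

  elements-distinct : AllPairs (λ r s → ¬ s - r ≈ 0#) elements
  elements-distinct = AllPairs.tabulate⁺ (λ {i} {j} i≢j s-r≈0 → i≢j (≡.trans (≡.sym (strictlyInverseˡ i))
    (≡.trans (to-cong (sym (x∙y⁻¹≈ε⇒x≈y (from j) (from i) s-r≈0))) (strictlyInverseˡ j))))

  -- The q scalars `ι a` are roots of x ^ q - x in the convolution algebra, and their differences
  -- are nonzero scalars, hence cancellable; so the polynomial splits and can be evaluated at `b`.
  -- Here `k` counts the zero coefficients between x and x ^ q.
  x^q≋x⇒annihilated : ∀ k → q ≡ 2 ℕ.+ k → ∀ {b} → (b ^ᵥ q) ≋ b →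
                      linearFactors (map ι elements) b ≋ 0ᵥ
  x^q≋x⇒annihilated k q≡2+k {b} b^q≋b = A.trans
    (A.sym (monic≈linearFactors (x^2+k-x k) (map ι elements) lengths
      (AllPairs.map⁺ (AllPairs.map cancellable elements-distinct))
      (All.map⁺ (All.tabulate⁺ (λ i → x^2+k≈x⇒root k (power (ι-^ q (x^q≈x 0<q (from i))))))) b))
    (x^2+k≈x⇒root k (power b^q≋b))
    where
    0<q : 0 < q
    0<q = ≡.subst (0 <_) (≡.sym q≡2+k) z<s

    power : ∀ {f g} → (f ^ᵥ q) ≋ g → (f ^ᵥ (2 ℕ.+ k)) ≋ g
    power {f} {g} = ≡.subst (λ r → (f ^ᵥ r) ≋ g) q≡2+k

    lengths : length (x^2+k-x k) ≡ length (map ι elements)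
    lengths = ≡.trans (≡.cong (2 ℕ.+_) (length-replicate k)) (≡.sym (≡.trans
      (length-map ι elements) (≡.trans (length-tabulate from) q≡2+k)))

    cancellable : ∀ {r s} → ¬ s - r ≈ 0# → Cancellable (ι s A.- ι r)
    cancellable {r} {s} s-r≉0 f f-killed x = x≉0∧xy≈0⇒y≈0 s-r≉0 (trans ([y-z]x≈yx-zx (f x) s r)
      (trans (sym (trans ([g-ι]⋆ (ι s) r f x) (+-congʳ (ι-⋆ s f x)))) (f-killed x)))

  module _ (σ : Permutation′ n) (b : Vector Carrier n)
           (σ-preserves : ∀ a f → ((b A.- ι a) ⋆ f) ≋ 0ᵥ → ((b A.- ι a) ⋆ act σ f) ≋ 0ᵥ) where

    Commutes : Vector Carrier n → Set ℓ
    Commutes f = act σ (b ⋆ f) ≋ (b ⋆ act σ f)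

    Commutes-resp : ∀ {f g} → f ≋ g → Commutes f → Commutes g
    Commutes-resp f≋g comm = A.trans (λ x → A.*-congˡ {b} (A.sym f≋g) (σ ⟨$⟩ˡ x))
      (A.trans comm (A.*-congˡ {b} (λ x → f≋g (σ ⟨$⟩ˡ x))))

    Commutes-+ : ∀ {f g} → Commutes f → Commutes g → Commutes (f +ᵥ g)
    Commutes-+ {f} {g} f-comm g-comm = A.trans (λ x → A.distribˡ b f g (σ ⟨$⟩ˡ x))
      (A.trans (A.+-cong f-comm g-comm) (A.sym (A.distribˡ b (act σ f) (act σ g))))

    ⋆-· : ∀ a f → (b ⋆ (a ·ᵥ f)) ≋ (a ·ᵥ (b ⋆ f))
    ⋆-· a f = A.trans (A.*-congˡ {b} (A.sym (ι-⋆ a f))) (A.trans (x∙yz≈y∙xz b (ι a) f) (ι-⋆ a (b ⋆ f)))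

    Commutes-· : ∀ a {f} → Commutes f → Commutes (a ·ᵥ f)
    Commutes-· a {f} comm = A.trans (λ x → ⋆-· a f (σ ⟨$⟩ˡ x))
      (A.trans (λ x → *-congˡ (comm x)) (A.sym (⋆-· a (act σ f))))

    -- By `σ-preserves`, both f and its image under σ are eigenvectors for `a`; on them convolution
    -- by `b` is multiplication by `a`, which commutes with any rearrangement of coordinates.
    eigenvector-commutes : ∀ a f → ((b A.- ι a) ⋆ f) ≋ 0ᵥ → Commutes f
    eigenvector-commutes a f f-killed =
      A.trans (λ x → eigen f-killed (σ ⟨$⟩ˡ x)) (A.sym (eigen (σ-preserves a f f-killed)))
      where
      eigen : ∀ {g} → ((b A.- ι a) ⋆ g) ≋ 0ᵥ → (b ⋆ g) ≋ (a ·ᵥ g)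
      eigen {g} g-killed = f-g≋0⇒f≋g _ _ (A.trans (A.sym ([g-ι]⋆ b a g)) g-killed)

    -- Two factors b - r and b - s at a time: f is a linear combination of
    -- (b - r) ⋆ f and (b - s) ⋆ f, each of which is killed by one factor less.
    killed-commutes : ∀ r rs → AllPairs (λ r s → ¬ s - r ≈ 0#) (r ∷ rs) →
                      ∀ f → (linearFactors (map ι (r ∷ rs)) b ⋆ f) ≋ 0ᵥ → Commutes f
    killed-commutes r []       _ f f-killed =
      eigenvector-commutes r f (A.trans (A.*-congʳ (A.sym (A.*-identityʳ (b A.- ι r)))) f-killed)
    killed-commutes r (s ∷ rs) ((s-r≉0 ∷ r≉rs) ∷ (s≉rs ∷ rs-distinct)) f f-killed =
      Commutes-resp combination (Commutes-+
        (Commutes-· u     (killed-commutes s rs (s≉rs ∷ rs-distinct) _ (A.trans (A.sym split-r) f-killed)))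
        (Commutes-· (- u) (killed-commutes r rs (r≉rs ∷ rs-distinct) _ (A.trans (A.sym split-s) f-killed))))
      where
      -- (b - r) - (b - s) is the scalar s - r; its inverse `u` recovers f from the two products.
      u = proj₁ (invertible (s - r) s-r≉0)
      P = linearFactors (map ι rs) b
      b-r = b A.- ι r
      b-s = b A.- ι s

      split-r : ((b-r ⋆ (b-s ⋆ P)) ⋆ f) ≋ ((b-s ⋆ P) ⋆ (b-r ⋆ f))
      split-r = xy∙z≈y∙xz b-r (b-s ⋆ P) f

      split-s : ((b-r ⋆ (b-s ⋆ P)) ⋆ f) ≋ ((b-r ⋆ P) ⋆ (b-s ⋆ f))
      split-s = A.trans (A.*-congʳ (x∙yz≈y∙xz b-r b-s P)) (xy∙z≈y∙xz b-s (b-r ⋆ P) f)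

      combination : ((u ·ᵥ (b-r ⋆ f)) +ᵥ ((- u) ·ᵥ (b-s ⋆ f))) ≋ f
      combination x = begin
        u * (b-r ⋆ f) x + - u * (b-s ⋆ f) x          ≈⟨ +-cong (*-congˡ ([g-ι]⋆ b r f x)) (trans (*-congˡ ([g-ι]⋆ b s f x)) (sym (-‿distribˡ-* u _))) ⟩
        u * (g - r * y) - u * (g - s * y)            ≈⟨ x[y-z]≈xy-xz u (g - r * y) (g - s * y) ⟨
        u * ((g - r * y) - (g - s * y))              ≈⟨ *-congˡ (+-congˡ (⁻¹-anti-homo-// g (s * y))) ⟩
        u * ((g - r * y) + (s * y - g))              ≈⟨ *-congˡ (trans (+-comm _ _) (+-assoc (s * y) (- g) _)) ⟩
        u * (s * y + (- g + (g - r * y)))            ≈⟨ *-congˡ (+-congˡ (\\-leftDividesʳ g (- (r * y)))) ⟩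
        u * (s * y - r * y)                          ≈⟨ *-congˡ ([y-z]x≈yx-zx y s r) ⟨
        u * ((s - r) * y)                            ≈⟨ *-assoc u (s - r) y ⟨
        u * (s - r) * y                              ≈⟨ *-congʳ (proj₁ (proj₂ (invertible (s - r) s-r≉0))) ⟩
        1# * y                                       ≈⟨ *-identityˡ y ⟩
        y                                            ∎
        where
        open import Relation.Binary.Reasoning.Setoid ≈-setoid
        y = f x
        g = (b ⋆ f) x

    q-fixed-commutes : ∀ k → q ≡ 2 ℕ.+ k → (b ^ᵥ q) ≋ b → ∀ f → Commutes f
    q-fixed-commutes k q≡2+k b^q≋b f = go elements elements-distinct (x^q≋x⇒annihilated k q≡2+k b^q≋b)
      where
      go : ∀ rs → AllPairs (λ r s → ¬ s - r ≈ 0#) rs → linearFactors (map ι rs) b ≋ 0ᵥ → Commutes f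
      -- With no factors the product is 1, and 1 = 0 collapses the algebra, so both sides vanish.
      go []       _        1≋0   =
        λ x → trans (≋0 (b ⋆ f) (σ ⟨$⟩ˡ x)) (sym (≋0 (b ⋆ act σ f) x))
        where
        ≋0 : ∀ g → g ≋ 0ᵥ
        ≋0 g = A.trans (A.sym (A.*-identityʳ g)) (A.trans (A.*-congˡ {g} 1≋0) (A.zeroʳ g))
      go (r ∷ rs) distinct P≋0 =
        killed-commutes r rs distinct f (A.trans (A.*-congʳ P≋0) (A.zeroˡ f))

  -- Codes range over predicates of an arbitrary level `r`, whereas the equation t ⋆ f = 0 lives at
  -- the level of the field's equality. Since that equality is decidable, membership is stored as
  -- the outcome of the decision, which sits at level zero and lifts to any `r`.
  annihilator : ∀ r → Vector Carrier n → CyclicCode n r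
  annihilator r t = record
    { words    = λ f → Lift r (True (killed? f))
    ; resp     = λ f≋g → wrap ∘ A.trans (A.*-congˡ {t} (A.sym f≋g)) ∘ unwrap
    ; 0-closed = wrap (A.zeroʳ t)
    ; +-closed = λ {f} {g} f∈ g∈ → wrap (A.trans (A.distribˡ t f g)
                   (A.trans (A.+-cong (unwrap f∈) (unwrap g∈)) (A.+-identityˡ 0ᵥ)))
    ; ·-closed = λ a {f} f∈ → wrap (A.trans (A.*-congˡ {t} (A.sym (ι-⋆ a f))) (closed (ι a) (unwrap f∈)))
    ; ⋆-closed = λ g f∈ → wrap (closed g (unwrap f∈))
    }
    where
    killed? : ∀ f → Dec ((t ⋆ f) ≋ 0ᵥ)
    killed? f = decidable _≈?_ (t ⋆ f) 0ᵥ
    wrap : ∀ {f} → (t ⋆ f) ≋ 0ᵥ → Lift r (True (killed? f))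
    wrap {f} = lift ∘ fromWitness {a? = killed? f}
    unwrap : ∀ {f} → Lift r (True (killed? f)) → (t ⋆ f) ≋ 0ᵥ
    unwrap {f} = toWitness {a? = killed? f} ∘ lower
    closed : ∀ g {f} → (t ⋆ f) ≋ 0ᵥ → (t ⋆ (g ⋆ f)) ≋ 0ᵥ
    closed g {f} f-killed = A.trans (x∙yz≈y∙xz t g f) (A.trans (A.*-congˡ {g} f-killed) (A.zeroʳ g))

  ⋂PAut-annihilator : ∀ r σ → σ ∈ ⋂ (CyclicCode n r) PAut →
                      ∀ t f → (t ⋆ f) ≋ 0ᵥ → (t ⋆ act σ f) ≋ 0ᵥ
  ⋂PAut-annihilator r σ σ∈ t f f-killed = toWitness {a? = decidable _≈?_ (t ⋆ act σ f) 0ᵥ}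
    (lower (proj₁ (σ∈ (annihilator r t)) (f , lift (fromWitness {a? = decidable _≈?_ (t ⋆ f) 0ᵥ} f-killed) , A.refl)))

-- The two inclusions

Aut-flip : ∀ {n} {π : Coloring n} {σ} → σ ∈ Aut π → flip σ ∈ Aut π
Aut-flip {π = π} {σ} σ∈ x y
  with σσ⁻¹ ← σ∈ (σ ⟨$⟩ˡ x) (σ ⟨$⟩ˡ y)
  rewrite inverseʳ σ {x} | inverseʳ σ {y} = proj₂ σσ⁻¹ , proj₁ σσ⁻¹

primePower⇒2+ : ∀ {q} → PrimePower q → ∃ λ k → q ≡ 2 ℕ.+ k
primePower⇒2+ (p , k , pp , 1≤k , ≡.refl) = _ , ≡.sym (ℕ.m+[n∸m]≡n (begin
  2         ≤⟨ ℕ.nonTrivial⇒n>1 p {{prime⇒nonTrivial pp}} ⟩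
  p         ≡⟨ ℕ.*-identityʳ p ⟨
  p ℕ.^ 1   ≤⟨ ℕ.^-monoʳ-≤ p {{prime⇒nonZero pp}} 1≤k ⟩
  p ℕ.^ k   ∎))
  where open ℕ.≤-Reasoning

module _ {c ℓ : Level} {q n : ℕ} .{{_ : NonZero n}} .{{_ : NonZero q}}
         (q-primePower : PrimePower q) (gcd≡1 : gcd n q ≡ 1) (F : FiniteField c ℓ q) where
  open FiniteField F hiding (zero)
  open Codes F
  open Residues {n}
  open Convolution F {n}
  open Intersection F {n}
  open VecEquality ≈-setoid using (_≋_)
  open import Algebra.Properties.CommutativeSemiring.Exp A.commutativeSemiring
    using () renaming (^-assocʳ to ^ᵥ-assocʳ; ^-congʳ to ^ᵥ-congʳ)
  open import Algebra.Properties.CommutativeSemigroup A.*-commutativeSemigroup using (x∙yz≈y∙xz)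

  private
    k-2 : ∃ λ k → q ≡ 2 ℕ.+ k
    k-2 = primePower⇒2+ q-primePower

    0<q : 0 < q
    0<q = ≡.subst (0 <_) (≡.sym (proj₂ k-2)) z<s

    m : ℕ
    m = proj₁ (order {q = q} gcd≡1)

    q⁻¹ : ℕ
    q⁻¹ = q ℕ.^ m

    qq⁻¹~1 : q ℕ.* q⁻¹ ~ 1
    qq⁻¹~1 = proj₂ (order {q = q} gcd≡1)

  ^q≋∘q⁻¹ : ∀ f → (f ^ᵥ q) ≋ (λ x → f (x ·ₙ q⁻¹))
  ^q≋∘q⁻¹ = go q-primePower
    where
    go : PrimePower q → ∀ f → (f ^ᵥ q) ≋ (λ x → f (x ·ₙ q⁻¹))
    go (p , k , pp , _ , q≡pᵏ) = ^q≋rescale {k = k} pp q≡pᵏ 0<q (~-trans (~-reflexive (ℕ.*-comm q⁻¹ q)) qq⁻¹~1)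

  ^q^i≋∘q⁻ⁱ : ∀ i f → (f ^ᵥ (q ℕ.^ i)) ≋ (λ x → f (x ·ₙ (q⁻¹ ℕ.^ i)))
  ^q^i≋∘q⁻ⁱ zero    f x = trans (A.*-identityʳ f x) (reflexive (≡.cong f (≡.sym (·ₙ-identity x))))
  ^q^i≋∘q⁻ⁱ (suc i) f x = begin
    (f ^ᵥ (q ℕ.* q ℕ.^ i)) x            ≈⟨ ^ᵥ-assocʳ f q (q ℕ.^ i) x ⟨
    ((f ^ᵥ q) ^ᵥ (q ℕ.^ i)) x           ≈⟨ ^q^i≋∘q⁻ⁱ i (f ^ᵥ q) x ⟩
    (f ^ᵥ q) (x ·ₙ (q⁻¹ ℕ.^ i))         ≈⟨ ^q≋∘q⁻¹ f (x ·ₙ (q⁻¹ ℕ.^ i)) ⟩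
    f (x ·ₙ (q⁻¹ ℕ.^ i) ·ₙ q⁻¹)         ≡⟨ ≡.cong f (·ₙ-assoc x (q⁻¹ ℕ.^ i) q⁻¹) ⟩
    f (x ·ₙ (q⁻¹ ℕ.^ i ℕ.* q⁻¹))        ≡⟨ ≡.cong (λ r → f (x ·ₙ r)) (ℕ.*-comm (q⁻¹ ℕ.^ i) q⁻¹) ⟩
    f (x ·ₙ (q⁻¹ ℕ.^ suc i))            ∎
    where open import Relation.Binary.Reasoning.Setoid ≈-setoid

  -- Dividing the argument by q for `suc m` times divides it by q ^ suc m, which is 1 modulo n. The
  -- algebra is thereby von Neumann regular, which stands in for its semisimplicity.
  ^q^order≋ : ∀ f → (f ^ᵥ (q ℕ.^ suc m)) ≋ f
  ^q^order≋ f x = trans (^q^i≋∘q⁻ⁱ (suc m) f x)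
    (reflexive (≡.cong f (≡.trans (·ₙ-cong x q⁻ᵐ~1) (·ₙ-identity x))))
    where
    q⁻ᵐ~1 : q⁻¹ ℕ.^ suc m ~ 1
    q⁻ᵐ~1 = ~-trans (~-reflexive (≡.trans (ℕ.^-*-assoc q m (suc m)) (≡.trans (≡.cong (q ℕ.^_) (ℕ.*-comm m (suc m)))
      (≡.sym (ℕ.^-*-assoc q (suc m) m))))) (~-trans (^-cong-~ m qq⁻¹~1) (~-reflexive (ℕ.^-zeroˡ m)))

  -- A single step along the orbit is e (x q) = (e ^ q) (x q) = e (x q q⁻¹) = e x.
  q-fixed⇒constant-on-orbits : ∀ {e} → (e ^ᵥ q) ≋ e → ∀ {x y} → y ∈ orbit ⟨ q mod n ⟩ x → e y ≈ e x
  q-fixed⇒constant-on-orbits {e} e^q≋e {x} y∈ with i , ≡.refl ← ∈orbit⇒≡·q^ gcd≡1 x y∈ = along i x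
    where
    step : ∀ x → e (x ·ₙ q) ≈ e x
    step x = trans (sym (e^q≋e (x ·ₙ q))) (trans (^q≋∘q⁻¹ e (x ·ₙ q))
      (reflexive (≡.cong e (·ₙ-inverse qq⁻¹~1 x))))
    along : ∀ i x → e (x ·ₙ (q ℕ.^ i)) ≈ e x
    along zero    x = reflexive (≡.cong e (·ₙ-identity x))
    along (suc i) x = trans (reflexive (≡.cong e (≡.sym (·ₙ-assoc x q (q ℕ.^ i)))))
                            (trans (along i (x ·ₙ q)) (step x))

  Aut⇒act∈ : ∀ {r} σ → σ ∈ Aut[ q , n ] → (𝒞 : CyclicCode n r) →
             ∀ {f} → f ∈ CyclicCode.words 𝒞 → act σ f ∈ CyclicCode.words 𝒞
  Aut⇒act∈ σ σ∈ 𝒞 {f} f∈ = resp (A.sym σf≋σf⋆e) (⋆-closed (act σ f) e∈)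
    where
    open CyclicCode 𝒞
    -- Chosen so that f ^ (2 + N) = f: one factor f can be split off to leave `e`, and `e` still
    -- contains another, which puts it into the ideal.
    N : ℕ
    N = q ℕ.^ suc m ℕ.∸ 2
    q^≡2+N : q ℕ.^ suc m ≡ 2 ℕ.+ N
    q^≡2+N = ≡.sym (ℕ.m+[n∸m]≡n (ℕ.≤-trans 2≤q (ℕ.m≤m*n q (q ℕ.^ m) {{ℕ.m^n≢0 q m}})))
      where
      2≤q : 2 ≤ q
      2≤q = ≡.subst (2 ≤_) (≡.sym (proj₂ k-2)) (ℕ.m≤m+n 2 _)

    e : Vector Carrier n
    e = f ^ᵥ suc N
    e∈ : e ∈ words
    e∈ = resp (⋆-comm (f ^ᵥ N) f) (⋆-closed (f ^ᵥ N) f∈)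
    f⋆e≋f : (f ⋆ e) ≋ f
    f⋆e≋f = A.trans (A.sym (^ᵥ-congʳ f q^≡2+N)) (^q^order≋ f)
    -- e ⋆ e = f ^ N ⋆ (f ⋆ e) = f ^ N ⋆ f = e; hence all positive powers of `e`, the q-th included,
    -- equal `e`.
    e⋆e≋e : (e ⋆ e) ≋ e
    e⋆e≋e = A.trans (⋆-assoc f (f ^ᵥ N) e) (A.trans (x∙yz≈y∙xz f (f ^ᵥ N) e)
      (A.trans (A.*-congˡ {f ^ᵥ N} f⋆e≋f) (⋆-comm (f ^ᵥ N) f)))
    e^q≋e : (e ^ᵥ q) ≋ e
    e^q≋e = A.trans (^ᵥ-congʳ e (proj₂ k-2)) (e^1+j≋e (suc (proj₁ k-2)))
      where
      e^1+j≋e : ∀ j → (e ^ᵥ suc j) ≋ e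
      e^1+j≋e zero    = A.*-identityʳ e
      e^1+j≋e (suc j) = A.trans (A.*-congˡ {e} (e^1+j≋e j)) e⋆e≋e
    -- The color of a pair (y, x) is the orbit of x - y, whence the swapped arguments of `σ∈`.
    e-inv : ∀ x y → e ((σ ⟨$⟩ʳ x) -ₙ (σ ⟨$⟩ʳ y)) ≈ e (x -ₙ y)
    e-inv x y = q-fixed⇒constant-on-orbits e^q≋e {x -ₙ y} (proj₁ (σ∈ y x) (orbit-refl gcd≡1 _))
    σf≋σf⋆e : act σ f ≋ (act σ f ⋆ e)
    σf≋σf⋆e = A.trans (λ x → A.trans (A.sym f⋆e≋f) (⋆-comm f e) (σ ⟨$⟩ˡ x))
      (A.trans (act-⋆ σ e e-inv f) (⋆-comm e (act σ f)))

  Aut⊆⋂PAut : ∀ {r σ} → σ ∈ Aut[ q , n ] → σ ∈ ⋂ (CyclicCode n r) PAut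
  Aut⊆⋂PAut {σ = σ} σ∈ 𝒞 =
      (λ (f , f∈ , g≋σf) → resp (A.sym g≋σf) (Aut⇒act∈ σ σ∈ 𝒞 f∈))
    -- `PAut` asks for equality of σ C and C; the reverse inclusion is the forward one for the
    -- inverse of σ.
    , (λ {g} g∈ → act (flip σ) g , Aut⇒act∈ (flip σ) (Aut-flip {σ = σ} σ∈) 𝒞 g∈ ,
                  λ x → reflexive (≡.cong g (≡.sym (inverseʳ σ))))
    where open CyclicCode 𝒞

  indicator : Fin n → Vector Carrier n
  indicator x z = if does (orbit? gcd≡1 x z) then 1# else 0#

  indicator-yes : ∀ x {z} → z ∈ orbit ⟨ q mod n ⟩ x → indicator x z ≈ 1#
  indicator-yes x {z} z∈ = reflexive (if-yes (orbit? gcd≡1 x z) z∈)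

  indicator-no : ∀ x {z} → ¬ z ∈ orbit ⟨ q mod n ⟩ x → indicator x z ≈ 0#
  indicator-no x {z} z∉ = reflexive (if-no (orbit? gcd≡1 x z) z∉)

  -- The q-th power rescales the argument by `q⁻¹`, itself a power of q, and so moves points only
  -- within their orbits.
  indicator-fixed : ∀ x → (indicator x ^ᵥ q) ≋ indicator x
  indicator-fixed x z = trans (^q≋∘q⁻¹ (indicator x) z) rescaled
    where
    rescaled : indicator x (z ·ₙ q⁻¹) ≈ indicator x z
    rescaled with orbit? gcd≡1 x z
    ... | yes z∈ = trans
      (indicator-yes x (orbit-trans gcd≡1 x z∈ (·q^∈orbit gcd≡1 z m)))
      (sym (indicator-yes x z∈))
    ... | no  z∉ = trans
      (indicator-no x (λ zq⁻¹∈ → z∉ (orbit-trans gcd≡1 x zq⁻¹∈ (orbit-sym gcd≡1 z (·q^∈orbit gcd≡1 z m)))))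
      (sym (indicator-no x z∉))

  -- Orbits that meet coincide, so both inclusions of colors follow once σ y - σ x lies in the orbit
  -- of y - x. The indicator `b` of that orbit takes the same value at the two differences, and 0 ≠
  -- 1 in the field decides.
  ⋂PAut⊆Aut : ∀ {r σ} → σ ∈ ⋂ (CyclicCode n r) PAut → σ ∈ Aut[ q , n ]
  ⋂PAut⊆Aut {r} {σ} σ∈ x y =
    orbit-trans gcd≡1 (y -ₙ x) σy-σx∈ , orbit-trans gcd≡1 ((σ ⟨$⟩ʳ y) -ₙ (σ ⟨$⟩ʳ x)) (orbit-sym gcd≡1 (y -ₙ x) σy-σx∈)
    where
    b : Vector Carrier n
    b = indicator (y -ₙ x)
    b-inv : b ((σ ⟨$⟩ʳ y) -ₙ (σ ⟨$⟩ʳ x)) ≈ b (y -ₙ x)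
    b-inv = act-⋆⁻¹ σ b (q-fixed-commutes σ b (λ a → ⋂PAut-annihilator r σ σ∈ (b A.- ι a))
      (proj₁ k-2) (proj₂ k-2) (indicator-fixed (y -ₙ x))) y x
    σy-σx∈ : ((σ ⟨$⟩ʳ y) -ₙ (σ ⟨$⟩ʳ x)) ∈ orbit ⟨ q mod n ⟩ (y -ₙ x)
    σy-σx∈ with orbit? gcd≡1 (y -ₙ x) ((σ ⟨$⟩ʳ y) -ₙ (σ ⟨$⟩ʳ x))
    ... | yes ∈orbit = ∈orbit
    ... | no  ∉orbit = contradiction (begin
      0#                                    ≈⟨ indicator-no (y -ₙ x) ∉orbit ⟨
      b ((σ ⟨$⟩ʳ y) -ₙ (σ ⟨$⟩ʳ x))          ≈⟨ b-inv ⟩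
      b (y -ₙ x)                            ≈⟨ indicator-yes (y -ₙ x) (orbit-refl gcd≡1 (y -ₙ x)) ⟩
      1#                                    ∎) 0≉1
      where open import Relation.Binary.Reasoning.Setoid ≈-setoid

theorem1 : ∀ {c ℓ r : Level} (q n : ℕ) .{{_ : NonZero n}} →
    PrimePower q → gcd n q ≡ 1 →
    (F : FiniteField c ℓ q) →
    ⋂ (Codes.CyclicCode F n r) (Codes.PAut F) ≐ Aut[ q , n ]
theorem1 q n q-primePower gcd≡1 F =
    (λ {σ} → ⋂PAut⊆Aut q-primePower gcd≡1 F {σ = σ})
  , (λ {σ} → Aut⊆⋂PAut q-primePower gcd≡1 F {σ = σ})
  where instance
  q-nonZero : NonZero q
  q-nonZero = ≡.subst NonZero (≡.sym (proj₂ (primePower⇒2+ q-primePower))) _
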